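{- For a finite simple graph $G$ the following statements are equivalent: (1) $G$ admits a $\{{}^bP_3,{}^rP_3,{}^bK_3,{}^rK_3,{}^{rbb}K_3\}$-free $2$-edge-colouring. (2) $G$ admits a $\{{}^bP_3,{}^rP_3,{}^bK_3,{}^rK_3,{}^{rrb}K_3\}$-free $2$-edge-colouring. (3) Each connected component of $G$ is an induced subgraph of either $K_4$, the diamond, an even cycle, or an odd-butterfly. (4) $G$ is a $\{K_5, \text{odd-hole}, \text{claw}, \text{house}, \text{bull}, K_4+l, \text{kite}, X_1, X_2, K_5-e, \text{gem}, 4\text{ -wheel}, \text{even-butterfly}\}$-free graph.
   Context: Graphs are finite and simple. A $2$-edge-colouring of $G$ assigns to every edge the colour red or blue (not necessarily properly). For a set $\mathcal F$ of $2$-edge-coloured graphs, a $2$-edge-colouring of $G$ is $\mathcal F$-free if no induced $2$-edge-coloured subgraph is isomorphic (preserving colours) to a member of $\mathcal F$. Patterns on three vertices: ${}^rP_3$ (resp. ${}^bP_3$) is the path on three vertices with both edges red (resp. blue); ${}^rK_3$ (resp. ${}^bK_3$) is the triangle with all edges red (resp. blue); ${}^{rrb}K_3$ is the triangle with two red and one blue edge; ${}^{rbb}K_3$ is the triangle with one red and two blue edges. For uncoloured graphs, being free of a set of graphs means containing no induced subgraph isomorphic to a member. Claw: $K_{1,3}$. Diamond: $K_4$ minus an edge. House: $C_4$ plus a new vertex adjacent to exactly two adjacent vertices of the $C_4$. Bull: a triangle plus two new non-adjacent vertices, each adjacent to exactly one vertex of the triangle, these two triangle vertices being distinct. $4$-wheel: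 join of $C_4$ and $K_1$. Gem: join of $P_4$ and $K_1$. Kite: diamond plus a new vertex adjacent to exactly one vertex of the diamond, which has degree $2$ in the diamond. $X_1$: diamond plus a new vertex adjacent to exactly the two vertices of degree $2$ of the diamond. $X_2$: diamond plus a new vertex adjacent to both vertices of degree $3$ and to exactly one vertex of degree $2$ of the diamond. $K_4+l$: $K_4$ plus a new vertex adjacent to exactly one vertex of the $K_4$. $K_5-e$: $K_5$ minus one edge. An odd-hole is a chordless cycle of odd length at least $5$; an even cycle is a cycle $C_{2m}$ with $m\ge 2$. For $n\ge 0$, the $n$-butterfly consists of two triangles joined by a path of length $n$ (one vertex of each triangle is an end of the path; for $n=0$ the two triangles share exactly one vertex). An even-butterfly (resp. odd-butterfly) is a $2n$-butterfly (resp. $(2n+1)$-butterfly) for some $n\ge 0$. -}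

module Defs where

open import Data.Bool.Base using (Bool; true; false; not; _∧_; _∨_; if_then_else_; T)
open import Data.Bool.Properties using (∨-comm)
open import Data.Fin.Base using (Fin; zero; suc; toℕ)
open import Data.Fin.Properties using (_≟_)
open import Data.Fin.Patterns using (0F; 1F; 2F; 3F)
open import Data.Fin.Subset using (Subset; _∈_; ⁅_⁆; _∪_; ⊤)
open import Data.Maybe.Base using (Maybe; just; nothing; is-just)
open import Data.Nat.Base using (ℕ; zero; suc; _+_; _*_; _≤_; _≡ᵇ_)
open import Data.Product.Base using (∃; _,_)
open import Data.Vec.Base using (lookup)
open import Function.Bundles using (_⇔_)
open import Function.Definitions using (Injective)
open import Relation.Binary.Construct.Closure.ReflexiveTransitive using (Star)
open import Relation.Binary.PropositionalEquality using (_≡_; refl; sym; cong; cong₂)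
open import Relation.Nullary.Decidable using (⌊_⌋; yes; no)
open import Relation.Nullary.Negation using (¬_; contradiction)

private
  variable
    n   : ℕ
    U V : Set

------------------------------------------------------------------------
-- Simple graphs and induced subgraphs

record Graph (V : Set) : Set where
  field
    adj        : V → V → Bool
    adj-sym    : ∀ u v → adj u v ≡ adj v u
    adj-irrefl : ∀ v → adj v v ≡ false

open Graph public

Adj : Graph V → V → V → Set
Adj G u v = T (adj G u v)

infix 4 _⊑_ _⊑ᶜ_

-- H ⊑ G : H is isomorphic to an induced subgraph of G.
record _⊑_ (H : Graph U) (G : Graph V) : Set where
  field
    embed     : U → V
    injective : Injective _≡_ _≡_ embed
    preserves : ∀ u v → adj G (embed u) (embed v) ≡ adj H u v

-- _∈ S is proof-irrelevant, so the vertices of G [ S ] are exactly the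
-- elements of S.
_[_] : Graph (Fin n) → (S : Subset n) → Graph (∃ λ v → v ∈ S)
G [ S ] = record
  { adj        = λ (u , _) (v , _) → adj G u v
  ; adj-sym    = λ (u , _) (v , _) → adj-sym G u v
  ; adj-irrefl = λ (v , _) → adj-irrefl G v
  }

-- S is the vertex set of a connected component of G.
IsComponent : Graph (Fin n) → Subset n → Set
IsComponent G S = ∃ λ v → ∀ u → u ∈ S ⇔ Star (Adj G) v u

-- Free 𝓕 G : no induced subgraph of G is isomorphic to a member of 𝓕.
Free : (∀ {k} → Graph (Fin k) → Set) → Graph V → Set
Free 𝓕 G = ∀ {k} {H : Graph (Fin k)} → 𝓕 H → ¬ (H ⊑ G)

------------------------------------------------------------------------
-- 2-edge-colourings

data Colour : Set where
  red blue : Colour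

-- colour u v is nothing exactly when uv is not an edge.
record Colouring (G : Graph V) : Set where
  field
    colour     : V → V → Maybe Colour
    colour-sym : ∀ u v → colour u v ≡ colour v u
    colour-adj : ∀ u v → is-just (colour u v) ≡ adj G u v

open Colouring public

-- d ⊑ᶜ c : the 2-edge-coloured graph (H , d) is isomorphic, colours
-- included, to an induced subgraph of (G , c).  Since non-edges have
-- colour nothing, preserving colour also preserves and reflects adjacency.
record _⊑ᶜ_ {H : Graph U} {G : Graph V}
            (d : Colouring H) (c : Colouring G) : Set where
  field
    embed     : U → V
    injective : Injective _≡_ _≡_ embed
    preserves : ∀ u v → colour c (embed u) (embed v) ≡ colour d u v

FreeColouring : (∀ {k} {H : Graph (Fin k)} → Colouring H → Set) →
                {G : Graph V} → Colouring G → Set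
FreeColouring 𝓕 c =
  ∀ {k} {H : Graph (Fin k)} {d : Colouring H} → 𝓕 d → ¬ (d ⊑ᶜ c)

------------------------------------------------------------------------
-- Constructions of graphs

-- Symmetric closure of r with loops removed.
symmetrise : (Fin n → Fin n → Bool) → Graph (Fin n)
symmetrise r = record
  { adj        = λ u v → not ⌊ u ≟ v ⌋ ∧ (r u v ∨ r v u)
  ; adj-sym    = λ u v → cong₂ _∧_ (cong not (≟-sym u v)) (∨-comm (r u v) (r v u))
  ; adj-irrefl = irrefl
  }
  where
  ≟-sym : ∀ u v → ⌊ u ≟ v ⌋ ≡ ⌊ v ≟ u ⌋
  ≟-sym u v with u ≟ v | v ≟ u
  ... | yes _ | yes _ = refl
  ... | no _  | no _  = refl
  ... | yes p | no ¬q = contradiction (sym p) ¬q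
  ... | no ¬p | yes q = contradiction (sym q) ¬p

  irrefl : ∀ v → not ⌊ v ≟ v ⌋ ∧ (r v v ∨ r v v) ≡ false
  irrefl v with v ≟ v
  ... | yes _ = refl
  ... | no ¬p = contradiction refl ¬p

-- G with the edge ab deleted.
deleteEdge : Graph (Fin n) → Fin n → Fin n → Graph (Fin n)
deleteEdge G a b = record
  { adj        = λ u v → adj G u v ∧ not (ab u v ∨ ab v u)
  ; adj-sym    = λ u v → cong₂ _∧_ (adj-sym G u v) (cong not (∨-comm (ab u v) (ab v u)))
  ; adj-irrefl = λ v → cong (_∧ not (ab v v ∨ ab v v)) (adj-irrefl G v)
  }
  where
  ab : Fin _ → Fin _ → Bool
  ab u v = ⌊ u ≟ a ⌋ ∧ ⌊ v ≟ b ⌋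

infixl 6 _+vertex_

-- Adds a vertex adjacent to exactly the members of S.  The new vertex is
-- zero, and the old vertex v becomes suc v.
_+vertex_ : Graph (Fin n) → Subset n → Graph (Fin (suc n))
G +vertex S = record
  { adj        = adj′
  ; adj-sym    = sym′
  ; adj-irrefl = irrefl′
  }
  where
  adj′ : Fin _ → Fin _ → Bool
  adj′ zero    zero    = false
  adj′ zero    (suc v) = lookup S v
  adj′ (suc u) zero    = lookup S u
  adj′ (suc u) (suc v) = adj G u v

  sym′ : ∀ u v → adj′ u v ≡ adj′ v u
  sym′ zero    zero    = refl
  sym′ zero    (suc v) = refl
  sym′ (suc u) zero    = refl
  sym′ (suc u) (suc v) = adj-sym G u v

  irrefl′ : ∀ v → adj′ v v ≡ false
  irrefl′ zero    = refl
  irrefl′ (suc v) = adj-irrefl G v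

edgeless : ∀ n → Graph (Fin n)
edgeless n = symmetrise λ _ _ → false

complete : ∀ n → Graph (Fin n)
complete n = symmetrise λ _ _ → true

-- The path on n vertices.
path : ∀ n → Graph (Fin n)
path n = symmetrise λ u v → suc (toℕ u) ≡ᵇ toℕ v

-- The path 0, …, n-1 closed by the edge {0, n-1}; a cycle when n ≥ 3.
cycle : ∀ n → Graph (Fin n)
cycle n = symmetrise λ u v →
  (suc (toℕ u) ≡ᵇ toℕ v) ∨ ((toℕ u ≡ᵇ 0) ∧ (suc (toℕ v) ≡ᵇ n))

-- The n-butterfly: the path 0, …, n+4 together with the edges {0, 2} and
-- {n+2, n+4}.  The triangles are {0, 1, 2} and {n+2, n+3, n+4}, joined by
-- the path 2, …, n+2 of length n.
butterfly : ∀ n → Graph (Fin (5 + n))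
butterfly n = symmetrise λ u v →
  (suc (toℕ u) ≡ᵇ toℕ v) ∨
  (((toℕ u ≡ᵇ 0) ∧ (toℕ v ≡ᵇ 2)) ∨ ((toℕ u ≡ᵇ n + 2) ∧ (toℕ v ≡ᵇ n + 4)))

-- Vertices 0 and 1 have degree 2; vertices 2 and 3 have degree 3.
diamond : Graph (Fin 4)
diamond = deleteEdge (complete 4) 0F 1F

claw : Graph (Fin 4)
claw = edgeless 3 +vertex ⊤

house bull K₄+l kite X₁ X₂ K₅-e gem 4-wheel : Graph (Fin 5)

house   = cycle 4 +vertex (⁅ 0F ⁆ ∪ ⁅ 1F ⁆)
-- After the first addition the triangle is {1, 2, 3}, and the pendant vertex
-- 0 is attached to 1.
bull    = complete 3 +vertex ⁅ 0F ⁆ +vertex ⁅ 2F ⁆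
K₄+l    = complete 4 +vertex ⁅ 0F ⁆
kite    = diamond +vertex ⁅ 0F ⁆
X₁      = diamond +vertex (⁅ 0F ⁆ ∪ ⁅ 1F ⁆)
X₂      = diamond +vertex (⁅ 2F ⁆ ∪ ⁅ 3F ⁆ ∪ ⁅ 0F ⁆)
K₅-e    = deleteEdge (complete 5) 0F 1F
gem     = path 4 +vertex ⊤
4-wheel = cycle 4 +vertex ⊤

data ForbiddenGraph : ∀ {k} → Graph (Fin k) → Set where
  is-K₅             : ForbiddenGraph (complete 5)
  is-odd-hole       : ∀ m → 2 ≤ m → ForbiddenGraph (cycle (2 * m + 1))
  is-claw           : ForbiddenGraph claw
  is-house          : ForbiddenGraph house
  is-bull           : ForbiddenGraph bull
  is-K₄+l           : ForbiddenGraph K₄+l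
  is-kite           : ForbiddenGraph kite
  is-X₁             : ForbiddenGraph X₁
  is-X₂             : ForbiddenGraph X₂
  is-K₅-e           : ForbiddenGraph K₅-e
  is-gem            : ForbiddenGraph gem
  is-4-wheel        : ForbiddenGraph 4-wheel
  is-even-butterfly : ∀ m → ForbiddenGraph (butterfly (2 * m))

------------------------------------------------------------------------
-- Coloured patterns

paint : (G : Graph V) (c : V → V → Colour) → (∀ u v → c u v ≡ c v u) →
        Colouring G
paint G c c-sym = record
  { colour     = λ u v → if adj G u v then just (c u v) else nothing
  ; colour-sym = λ u v → cong₂ (λ b x → if b then x else nothing)
                                (adj-sym G u v) (cong just (c-sym u v))
  ; colour-adj = λ u v → is-just-if (adj G u v)
  }
  where
  is-just-if : ∀ {x : Colour} b → is-just (if b then just x else nothing) ≡ b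
  is-just-if true  = refl
  is-just-if false = refl

monochromatic : (G : Graph V) → Colour → Colouring G
monochromatic G x = paint G (λ _ _ → x) (λ _ _ → refl)

ʳP₃ ᵇP₃ : Colouring (path 3)
ʳP₃ = monochromatic (path 3) red
ᵇP₃ = monochromatic (path 3) blue

-- The two edges at vertex 0 get colour x, the third edge gets colour y.
triangle : Colour → Colour → Colouring (complete 3)
triangle x y = paint (complete 3) c c-sym
  where
  c : Fin 3 → Fin 3 → Colour
  c zero    _       = x
  c (suc _) zero    = x
  c (suc _) (suc _) = y

  c-sym : ∀ u v → c u v ≡ c v u
  c-sym zero    zero    = refl
  c-sym zero    (suc _) = refl
  c-sym (suc _) zero    = refl
  c-sym (suc _) (suc _) = refl

ʳK₃ ᵇK₃ ʳʳᵇK₃ ʳᵇᵇK₃ : Colouring (complete 3)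
ʳK₃   = monochromatic (complete 3) red
ᵇK₃   = monochromatic (complete 3) blue
ʳʳᵇK₃ = triangle red blue
ʳᵇᵇK₃ = triangle blue red

-- The set {ᵇP₃, ʳP₃, ᵇK₃, ʳK₃, t}.
data MonochromaticOr (t : Colouring (complete 3)) :
     ∀ {k} {H : Graph (Fin k)} → Colouring H → Set where
  is-ᵇP₃ : MonochromaticOr t ᵇP₃
  is-ʳP₃ : MonochromaticOr t ʳP₃
  is-ᵇK₃ : MonochromaticOr t ᵇK₃
  is-ʳK₃ : MonochromaticOr t ʳK₃
  is-t   : MonochromaticOr t t

{-# OPTIONS --safe #-}
module Submission where

-- Exchanging the colours gives (1) ⇔ (2), and the rest is the cycle
-- (1) ⇒ (4) ⇒ (3) ⇒ (1).
--
-- A colouring is as in (1) exactly when among any three vertices spanning at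
-- least two edges exactly one edge is blue.  Hence colours alternate along
-- induced paths and an edge pendant at a triangle is blue.  This excludes odd
-- holes and even butterflies and, conversely, colours even cycles and odd
-- butterflies; the other forbidden graphs are excluded by trying all colourings.
--
-- For (4) ⇒ (3), a component containing a K₄ or a diamond is equal to it, as a
-- further vertex attached to it would create a forbidden subgraph.  In any other
-- component a triangle has at most one neighbour outside it.  By claw-freeness,
-- an induced path starting at a triangle, or else at a vertex of degree at most 1,
-- then has a unique prolongation until it exhausts the component, possibly with a
-- second triangle.  If instead all degrees are 2, the same applies after removing
-- a vertex, which then closes the path to a cycle.

open import Defs
open import Algebra.Properties.CommutativeSemigroup using (x∙yz≈y∙xz)
open import Data.Bool.Base using (Bool; true; false; _∧_; _∨_; T; not; if_then_else_)
import Data.Bool.Properties as Bool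
open import Data.Fin.Base using (Fin; zero; suc; toℕ; fromℕ; _<_)
open import Data.Fin.Patterns using (0F; 1F; 2F; 3F; 4F)
open import Data.Fin.Properties using (_≟_; all?; any?; suc-injective; injective⇒≤; <-cmp)
open import Data.Fin.Subset using (Subset; _∈_; ⁅_⁆) renaming (⊥ to ∅)
open import Data.Fin.Subset.Properties using (_∈?_)
open import Data.List.Base using (List; []; _∷_; allFin)
open import Data.List.Membership.Propositional using () renaming (_∈_ to _∈ˡ_)
open import Data.List.Membership.Propositional.Properties using (∈-allFin)
open import Data.List.Relation.Unary.Any using (here; there)
open import Data.Maybe.Base as Maybe using (Maybe; just; nothing; is-just)
import Data.Maybe.Properties as Maybe
open import Data.Nat.Base using (ℕ; zero; suc; _+_; _*_; _≤_; _≡ᵇ_; z≤n; s≤s)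
import Data.Nat.Properties as ℕ
open import Data.Nat.Tactic.RingSolver using (solve-∀)
open import Data.Product.Base using (∃; ∃₂; Σ; _×_; _,_; proj₁; proj₂)
open import Data.Sum.Base using (_⊎_; inj₁; inj₂)
open import Data.Unit.Base using (⊤; tt)
open import Data.Vec.Base using (Vec; []; _∷_; lookup; tabulate)
open import Data.Vec.Properties
  using (lookup-replicate; lookup∘tabulate; lookup⇒[]=; []=⇒lookup; tabulate-cong; ≡-dec)
open import Data.Vec.Properties.WithK using ([]=-irrelevant)
open import Function.Base using (_∘_; id; _|>_)
open import Function.Bundles using (_⇔_; mk⇔; Equivalence)
open import Relation.Binary.Construct.Closure.ReflexiveTransitive as Star using (Star; ε; _◅_; _◅◅_)
open import Relation.Binary.Definitions using (tri<; tri≈; tri>)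
open import Relation.Binary.PropositionalEquality hiding ([_])
open import Relation.Nullary.Decidable
open import Relation.Nullary.Negation using (¬_; contradiction)
open import Relation.Unary using (Decidable)

-- `cycle` and `butterfly` are defined by arithmetic on vertex numbers, which gives no handle for
-- induction. They are therefore first identified with graphs built by adding one vertex at a time,
-- `closedPath` and `twoTriangles`, both based on `grow`. This single description serves to
-- propagate a colour along a path in (1) ⇒ (4), to construct a colouring in (3) ⇒ (1), and as the
-- invariant of the walk through a component in (4) ⇒ (3). Freeness of a colouring is traded for
-- `Good`, which mentions neither embeddings nor patterns: it passes to induced subgraphs at once
-- and is decidable on concrete graphs. In (3) ⇒ (1) the obstacle is to choose one colouring per
-- component consistently for all its vertices. The choice is made from the vertex set of the
-- component, computed canonically by a decision procedure for reachability.

private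
  variable
    h k n : ℕ
    U V W : Set

-- Induced subgraphs and explicit embeddings

T⇒≡true : ∀ {b} → T b → b ≡ true
T⇒≡true {true} _ = refl

¬T⇒≡false : ∀ {b} → ¬ T b → b ≡ false
¬T⇒≡false {false} _  = refl
¬T⇒≡false {true}  ¬t = contradiction tt ¬t

≡true⇒T : ∀ {b} → b ≡ true → T b
≡true⇒T refl = tt

≡false⇒¬T : ∀ {b} → b ≡ false → ¬ T b
≡false⇒¬T refl ()

Adj-sym : (G : Graph V) {u v : V} → Adj G u v → Adj G v u
Adj-sym G {u} {v} = subst T (adj-sym G u v)

Adj⇒≢ : (G : Graph V) {u v : V} → Adj G u v → u ≢ v
Adj⇒≢ G {u} uv refl = subst T (adj-irrefl G u) uv

open _⊑_

⊑-trans : {F : Graph U} {G : Graph V} {H : Graph W} → F ⊑ G → G ⊑ H → F ⊑ H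
⊑-trans e f = record
  { embed     = embed f ∘ embed e
  ; injective = injective e ∘ injective f
  ; preserves = λ u v → trans (preserves f _ _) (preserves e u v)
  }

infix 4 _≐_

_≐_ : Graph V → Graph V → Set
G ≐ H = ∀ u v → adj G u v ≡ adj H u v

≐⇒⊑ : {G H : Graph V} → G ≐ H → G ⊑ H
≐⇒⊑ eq = record { embed = id ; injective = id ; preserves = λ u v → sym (eq u v) }

≐⇒⊒ : {G H : Graph V} → G ≐ H → H ⊑ G
≐⇒⊒ eq = record { embed = id ; injective = id ; preserves = eq }

⊑+vertex : (H : Graph (Fin n)) (S : Subset n) → H ⊑ H +vertex S
⊑+vertex H S = record { embed = suc ; injective = suc-injective ; preserves = λ _ _ → refl }

-- A vector instead of a function, so that a concrete embedding is checked by evaluation (`by-map`)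
-- and all candidates can be searched (`contains?`).
IsEmbedding : Graph (Fin k) → Graph V → Vec V k → Set
IsEmbedding H G f = ∀ u v →
  (lookup f u ≡ lookup f v → u ≡ v) × adj G (lookup f u) (lookup f v) ≡ adj H u v

isEmbedding? : (H : Graph (Fin k)) (G : Graph (Fin n)) → Decidable (IsEmbedding H G)
isEmbedding? H G f = all? λ u → all? λ v →
  (lookup f u ≟ lookup f v →-dec u ≟ v) ×-dec (adj G (lookup f u) (lookup f v) Bool.≟ adj H u v)

toEmbedding : {H : Graph (Fin k)} {G : Graph V} (f : Vec V k) → IsEmbedding H G f → H ⊑ G
toEmbedding f is = record
  { embed     = lookup f
  ; injective = λ {u} {v} → proj₁ (is u v)
  ; preserves = λ u v → proj₂ (is u v)
  }

by-map : {H : Graph (Fin k)} {G : Graph (Fin n)} (f : Vec (Fin n) k) →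
         {True (isEmbedding? H G f)} → H ⊑ G
by-map f {is} = toEmbedding f (toWitness is)

extend : {H : Graph (Fin k)} {G : Graph V} (S : Subset k) (e : H ⊑ G) (y : V) →
         (∀ i → embed e i ≢ y) → (∀ i → adj G y (embed e i) ≡ lookup S i) →
         H +vertex S ⊑ G
extend {H = H} {G} S e y new row = record
  { embed     = f
  ; injective = λ {u} {v} → inj u v
  ; preserves = pres
  }
  where
  f : Fin _ → _
  f zero    = y
  f (suc i) = embed e i
  inj : ∀ u v → f u ≡ f v → u ≡ v
  inj zero    zero    _  = refl
  inj zero    (suc v) eq = contradiction (sym eq) (new v)
  inj (suc u) zero    eq = contradiction eq (new u)
  inj (suc u) (suc v) eq = cong suc (injective e eq)
  pres : ∀ u v → adj G (f u) (f v) ≡ adj (H +vertex S) u v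
  pres zero    zero    = adj-irrefl G y
  pres zero    (suc v) = row v
  pres (suc u) zero    = trans (adj-sym G _ _) (row u)
  pres (suc u) (suc v) = preserves e u v

module _ (G : Graph V) where

  Link : V → V → Bool → Set
  Link u v true  = Adj G u v
  Link u v false = u ≢ v × ¬ Adj G u v

  LinkRow : (Fin k → Bool) → V → Vec V k → Set
  LinkRow r x []       = ⊤
  LinkRow r x (y ∷ ys) = Link x y (r zero) × LinkRow (r ∘ suc) x ys

  tailGraph : Graph (Fin (suc k)) → Graph (Fin k)
  tailGraph H = record
    { adj        = λ u v → adj H (suc u) (suc v)
    ; adj-sym    = λ u v → adj-sym H (suc u) (suc v)
    ; adj-irrefl = λ v → adj-irrefl H (suc v)
    }

  -- For concrete `H` this unfolds to one entry per pair of positions, listed row by row, so a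
  -- pattern in an arbitrary `G` is exhibited by its edges and non-edges. Only non-edges carry an
  -- inequality; for edges it follows from the absence of loops.
  Links : Graph (Fin k) → Vec V k → Set
  Links H []       = ⊤
  Links H (x ∷ xs) = LinkRow (λ i → adj H zero (suc i)) x xs × Links (tailGraph H) xs

  private
    link : ∀ {u v} b → Link u v b → u ≢ v × adj G u v ≡ b
    link true  uv          = Adj⇒≢ G uv , T⇒≡true uv
    link false (u≢v , ¬uv) = u≢v , ¬T⇒≡false ¬uv

    row : (r : Fin k → Bool) (x : V) (xs : Vec V k) → LinkRow r x xs →
          ∀ i → x ≢ lookup xs i × adj G x (lookup xs i) ≡ r i
    row r x (y ∷ ys) (l , ls) zero    = link (r zero) l
    row r x (y ∷ ys) (l , ls) (suc i) = row (r ∘ suc) x ys ls i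

    embedding : (H : Graph (Fin k)) (xs : Vec V k) → Links H xs → IsEmbedding H G xs
    embedding H (x ∷ xs) (r , ls) zero zero = (λ _ → refl) , trans (adj-irrefl G x) (sym (adj-irrefl H zero))
    embedding H (x ∷ xs) (r , ls) zero (suc v) with row _ x xs r v
    ... | ≢ , eq = (λ p → contradiction p ≢) , eq
    embedding H (x ∷ xs) (r , ls) (suc u) zero with row _ x xs r u
    ... | ≢ , eq = (λ p → contradiction (sym p) ≢) , trans (adj-sym G _ _) (trans eq (adj-sym H _ _))
    embedding H (x ∷ xs) (r , ls) (suc u) (suc v) with embedding (tailGraph H) xs ls u v
    ... | inj , eq = (cong suc ∘ inj) , eq

  build : (H : Graph (Fin k)) (xs : Vec V k) → Links H xs → H ⊑ G
  build H xs ls = toEmbedding xs (embedding H xs ls)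

-- Paths, cycles and butterflies built vertex by vertex

lookup-∅ : (i : Fin n) → lookup ∅ i ≡ false
lookup-∅ i = lookup-replicate i false

lookup-⁅⁆-≡ : (i : Fin n) → lookup ⁅ i ⁆ i ≡ true
lookup-⁅⁆-≡ zero    = refl
lookup-⁅⁆-≡ (suc i) = lookup-⁅⁆-≡ i

lookup-⁅⁆-≢ : {i j : Fin n} → j ≢ i → lookup ⁅ i ⁆ j ≡ false
lookup-⁅⁆-≢ {i = zero}  {zero}  j≢i = contradiction refl j≢i
lookup-⁅⁆-≢ {i = zero}  {suc j} _   = lookup-∅ j
lookup-⁅⁆-≢ {i = suc i} {zero}  _   = refl
lookup-⁅⁆-≢ {i = suc i} {suc j} j≢i = lookup-⁅⁆-≢ (j≢i ∘ cong suc)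

-- Each new pendant vertex is attached to the previous one.  The newest vertex
-- is 0, and the vertex v of H has become anchor j v.
grow : Graph (Fin (2 + h)) → ∀ j → Graph (Fin (2 + (j + h)))
grow H zero    = H
grow H (suc j) = grow H j +vertex ⁅ 0F ⁆

anchor : ∀ j → Fin (2 + h) → Fin (2 + (j + h))
anchor zero    i = i
anchor (suc j) i = suc (anchor j i)

anchor-injective : ∀ j {u v : Fin (2 + h)} → anchor j u ≡ anchor j v → u ≡ v
anchor-injective zero    eq = eq
anchor-injective (suc j) eq = anchor-injective j (suc-injective eq)

adj-anchor : (H : Graph (Fin (2 + h))) → ∀ j u v → adj (grow H j) (anchor j u) (anchor j v) ≡ adj H u v
adj-anchor H zero    u v = refl
adj-anchor H (suc j) u v = adj-anchor H j u v

anchor-last : ∀ j → anchor j (fromℕ (suc h)) ≡ fromℕ (suc (j + h))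
anchor-last zero    = refl
anchor-last (suc j) = cong suc (anchor-last j)

adj-grow-01 : (H : Graph (Fin (2 + h))) → adj H 0F 1F ≡ true → ∀ j → adj (grow H j) 0F 1F ≡ true
adj-grow-01 H e zero    = e
adj-grow-01 H e (suc j) = refl

K₂ : Graph (Fin 2)
K₂ = complete 2

K₃ : Graph (Fin 3)
K₃ = complete 3

adj-grow-K₂-0 : ∀ j v → adj (grow K₂ j) 0F (suc (suc v)) ≡ false
adj-grow-K₂-0 (suc j) v = lookup-∅ v

ends : ∀ j → Subset (2 + (j + 0))
ends j = true ∷ ⁅ fromℕ (j + 0) ⁆

-- The cycle of length `3 + j`. The summand 0 here, and 1 for `twoTriangles`, is the `h` of the base
-- graph `K₂` or `K₃`.
closedPath : ∀ j → Graph (Fin (3 + (j + 0)))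
closedPath j = grow K₂ j +vertex ends j

-- The `j`-butterfly: the last two vertices form the second triangle with the end of the tail of
-- `grow K₃ j`, whose length is `j`.
twoTriangles : ∀ j → Graph (Fin (4 + (j + 1)))
twoTriangles j = grow K₃ j +vertex ⁅ 0F ⁆ +vertex (true ∷ true ∷ ∅)

-- With a relation on `ℕ`, deleting vertex 0 is the shift from `r i j` to `r (suc i) (suc j)`; this
-- is what `+vertex-≐` exploits.
fromRelation : (ℕ → ℕ → Bool) → ∀ n → Graph (Fin n)
fromRelation r n = symmetrise λ u v → r (toℕ u) (toℕ v)

pathRel : ℕ → ℕ → Bool
pathRel i j = suc i ≡ᵇ j

cycleRel : ℕ → ℕ → ℕ → Bool
cycleRel n i j = (suc i ≡ᵇ j) ∨ ((i ≡ᵇ 0) ∧ (suc j ≡ᵇ n))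

-- A tail of `n` edges ending in a triangle. It is what the shift leaves of a butterfly, with a tail
-- longer by one.
lollipopRel : ℕ → ℕ → ℕ → Bool
lollipopRel n i j = (suc i ≡ᵇ j) ∨ ((i ≡ᵇ n) ∧ (j ≡ᵇ 2 + n))

butterflyRel : ℕ → ℕ → ℕ → Bool
butterflyRel n i j =
  (suc i ≡ᵇ j) ∨ (((i ≡ᵇ 0) ∧ (j ≡ᵇ 2)) ∨ ((i ≡ᵇ n + 2) ∧ (j ≡ᵇ n + 4)))

+vertex-≐ : {H : Graph (Fin n)} (S : Subset n) (r s : ℕ → ℕ → Bool) →
  (∀ v → lookup S v ≡ r 0 (suc (toℕ v)) ∨ r (suc (toℕ v)) 0) →
  (∀ i j → r (suc i) (suc j) ≡ s i j) →
  H ≐ fromRelation s n → H +vertex S ≐ fromRelation r (suc n)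
+vertex-≐ S r s row r≡s eq zero    zero    = refl
+vertex-≐ S r s row r≡s eq zero    (suc v) = row v
+vertex-≐ S r s row r≡s eq (suc u) zero    = trans (row u) (Bool.∨-comm (r 0 (suc (toℕ u))) _)
+vertex-≐ {n} {H} S r s row r≡s eq (suc u) (suc v) = begin
  adj H u v                                               ≡⟨ eq u v ⟩
  not ⌊ u ≟ v ⌋ ∧ (s i j ∨ s j i)                         ≡⟨ cong₂ (λ x y → not x ∧ y) ≟-suc (cong₂ _∨_ (r≡s i j) (r≡s j i)) ⟨
  adj (fromRelation r (suc n)) (suc u) (suc v)            ∎
  where
  open ≡-Reasoning
  i j : ℕ
  i = toℕ u
  j = toℕ v
  ≟-suc : ⌊ suc u ≟ suc v ⌋ ≡ ⌊ u ≟ v ⌋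
  ≟-suc = trans (isYes≗does (suc u ≟ suc v)) (sym (isYes≗does (u ≟ v)))

lookup-⁅0⁆ : (v : Fin (suc n)) → lookup ⁅ 0F ⁆ v ≡ (0 ≡ᵇ toℕ v)
lookup-⁅0⁆ zero    = refl
lookup-⁅0⁆ (suc v) = lookup-∅ v

grow-K₂≐path : ∀ j → grow K₂ j ≐ path (2 + (j + 0))
grow-K₂≐path zero    = from-yes (all? λ u → all? λ v → adj K₂ u v Bool.≟ adj (path 2) u v)
grow-K₂≐path (suc j) = +vertex-≐ ⁅ 0F ⁆ pathRel pathRel
  (λ v → trans (lookup-⁅0⁆ v) (sym (Bool.∨-identityʳ _))) (λ _ _ → refl) (grow-K₂≐path j)

lookup-⁅fromℕ⁆ : ∀ m (v : Fin (suc m)) → lookup ⁅ fromℕ m ⁆ v ≡ (toℕ v ≡ᵇ m)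
lookup-⁅fromℕ⁆ zero    zero    = refl
lookup-⁅fromℕ⁆ (suc m) zero    = refl
lookup-⁅fromℕ⁆ (suc m) (suc v) = lookup-⁅fromℕ⁆ m v

closedPath≐cycle : ∀ j → closedPath j ≐ cycle (3 + (j + 0))
closedPath≐cycle j = +vertex-≐ (ends j) (cycleRel (3 + (j + 0))) pathRel row
  (λ _ _ → Bool.∨-identityʳ _) (grow-K₂≐path j)
  where
  row : ∀ v → lookup (ends j) v ≡ ((0 ≡ᵇ toℕ v) ∨ (toℕ v ≡ᵇ suc (j + 0))) ∨ false
  row zero    = refl
  row (suc v) = trans (lookup-⁅fromℕ⁆ (j + 0) v) (sym (Bool.∨-identityʳ _))

grow-K₃≐lollipop : ∀ j → grow K₃ j ≐ fromRelation (lollipopRel j) (2 + (j + 1))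
grow-K₃≐lollipop zero    =
  from-yes (all? λ u → all? λ v → adj K₃ u v Bool.≟ adj (fromRelation (lollipopRel 0) 3) u v)
grow-K₃≐lollipop (suc j) = +vertex-≐ ⁅ 0F ⁆ (lollipopRel (suc j)) (lollipopRel j) row
  (λ _ _ → refl) (grow-K₃≐lollipop j)
  where
  row : ∀ v → lookup ⁅ 0F ⁆ v ≡ ((0 ≡ᵇ toℕ v) ∨ false) ∨ ((toℕ v ≡ᵇ j) ∧ false)
  row zero    = refl
  row (suc v) = trans (lookup-∅ v) (sym (Bool.∧-zeroʳ _))

-- butterfly j has its vertices in Fin (5 + j) instead.
twoTriangles≐ : ∀ j → twoTriangles j ≐ fromRelation (butterflyRel j) (4 + (j + 1))
twoTriangles≐ j =
  +vertex-≐ (true ∷ true ∷ ∅) (butterflyRel j) (lollipopRel (suc j)) row₁ rel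
    (+vertex-≐ ⁅ 0F ⁆ (lollipopRel (suc j)) (lollipopRel j) row₂ (λ _ _ → refl) (grow-K₃≐lollipop j))
  where
  rel : ∀ u v → butterflyRel j (suc u) (suc v) ≡ lollipopRel (suc j) u v
  rel u v rewrite ℕ.+-comm j 2 | ℕ.+-comm j 4 = refl

  row₁ : ∀ v → lookup (true ∷ true ∷ ∅) v ≡ butterflyRel j 0 (suc (toℕ v)) ∨ butterflyRel j (suc (toℕ v)) 0
  row₁ v rewrite ℕ.+-comm j 2 | ℕ.+-comm j 4 = row v
    where
    row : ∀ (v : Fin (3 + (j + 1))) → lookup (true ∷ true ∷ ∅) v ≡
          ((0 ≡ᵇ toℕ v) ∨ (toℕ v ≡ᵇ 1) ∨ false) ∨ ((toℕ v ≡ᵇ 1 + j) ∧ false)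
    row 0F            = refl
    row 1F            = refl
    row (suc (suc v)) = trans (lookup-∅ v) (sym (Bool.∧-zeroʳ _))

  row₂ : ∀ v → lookup ⁅ 0F ⁆ v ≡ ((0 ≡ᵇ toℕ v) ∨ false) ∨ ((toℕ v ≡ᵇ j) ∧ false)
  row₂ 0F      = refl
  row₂ (suc v) = trans (lookup-∅ v) (sym (Bool.∧-zeroʳ _))

4+[j+1]≡5+j : ∀ j → 4 + (j + 1) ≡ 5 + j
4+[j+1]≡5+j j = cong (4 +_) (ℕ.+-comm j 1)

twoTriangles⊑butterfly : ∀ j → twoTriangles j ⊑ butterfly j
twoTriangles⊑butterfly j = subst (λ n → twoTriangles j ⊑ fromRelation (butterflyRel j) n)
  (4+[j+1]≡5+j j) (≐⇒⊑ {H = fromRelation (butterflyRel j) (4 + (j + 1))} (twoTriangles≐ j))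

butterfly⊑twoTriangles : ∀ j → butterfly j ⊑ twoTriangles j
butterfly⊑twoTriangles j = subst (λ n → fromRelation (butterflyRel j) n ⊑ twoTriangles j)
  (4+[j+1]≡5+j j) (≐⇒⊒ {H = fromRelation (butterflyRel j) (4 + (j + 1))} (twoTriangles≐ j))

closedPath⊑cycle : ∀ j → closedPath j ⊑ cycle (3 + j)
closedPath⊑cycle j = subst (λ m → closedPath j ⊑ cycle (3 + m)) (ℕ.+-identityʳ j)
  (≐⇒⊑ {H = cycle (3 + (j + 0))} (closedPath≐cycle j))

cycle⊑closedPath : ∀ j → cycle (3 + j) ⊑ closedPath j
cycle⊑closedPath j = subst (λ m → cycle (3 + m) ⊑ closedPath j) (ℕ.+-identityʳ j)
  (≐⇒⊒ {H = cycle (3 + (j + 0))} (closedPath≐cycle j))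

-- Colourings as conditions on triples of vertices

flip : Colour → Colour
flip red  = blue
flip blue = red

flip-flip : ∀ x → flip (flip x) ≡ x
flip-flip red  = refl
flip-flip blue = refl

-- With these weights, the multiset of colours of a triple can be read off
-- the total weight.
weight : Maybe Colour → ℕ
weight nothing     = 0
weight (just red)  = 1
weight (just blue) = 4

-- The weights 0, 1 and 4 mean at most one edge; 5 and 6 mean one blue edge with one or two red
-- ones. The rejected totals 2, 3, 8, 9 and 12 are two or three reds, two blues, two blues with a
-- red, and three blues.
valid : ℕ → Bool
valid 0 = true
valid 1 = true
valid 4 = true
valid 5 = true
valid 6 = true
valid _ = false

-- If a triple has at least two edges, exactly one of them is blue.
ok : (x y z : Maybe Colour) → Bool
ok x y z = valid (weight x + (weight y + weight z))

ok-swapˡ : ∀ x y z → T (ok x y z) → T (ok y x z)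
ok-swapˡ x y z = subst (T ∘ valid) (x∙yz≈y∙xz ℕ.+-commutativeSemigroup (weight x) (weight y) (weight z))

ok-swapʳ : ∀ x y z → T (ok x y z) → T (ok x z y)
ok-swapʳ x y z = subst (λ w → T (valid (weight x + w))) (ℕ.+-comm (weight y) (weight z))

Good : {G : Graph V} → Colouring G → Set
Good c = ∀ u v w → u ≢ v → v ≢ w → u ≢ w → T (ok (colour c u v) (colour c v w) (colour c u w))

module _ {G : Graph V} (c : Colouring G) where

  colour-adjacent : ∀ {u v} → adj G u v ≡ true → ∃ λ x → colour c u v ≡ just x
  colour-adjacent {u} {v} uv with colour c u v in eq
  ... | just x  = x , refl
  ... | nothing = contradiction (trans (sym uv) (trans (sym (colour-adj c u v)) (cong is-just eq))) λ ()

  colour-nonadjacent : ∀ {u v} → adj G u v ≡ false → colour c u v ≡ nothing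
  colour-nonadjacent {u} {v} uv with colour c u v in eq
  ... | nothing = refl
  ... | just x  = contradiction (trans (sym uv) (trans (sym (colour-adj c u v)) (cong is-just eq))) λ ()

  colour-loop : ∀ v → colour c v v ≡ nothing
  colour-loop v = colour-nonadjacent (adj-irrefl G v)

module _ {H : Graph U} {G : Graph V} (e : H ⊑ G) where

  pullback : Colouring G → Colouring H
  pullback c = record
    { colour     = λ u v → colour c (embed e u) (embed e v)
    ; colour-sym = λ u v → colour-sym c _ _
    ; colour-adj = λ u v → trans (colour-adj c _ _) (preserves e u v)
    }

  pullback-good : (c : Colouring G) → Good c → Good (pullback c)
  pullback-good c good u v w u≢v v≢w u≢w =
    good _ _ _ (u≢v ∘ injective e) (v≢w ∘ injective e) (u≢w ∘ injective e)

module _ {G : Graph V} (c : Colouring G) where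

  Good⇒Free : Good c → FreeColouring (MonochromaticOr ʳᵇᵇK₃) c
  Good⇒Free good = impossible
    where
    ok-pattern : ∀ {H : Graph (Fin 3)} {d : Colouring H} → d ⊑ᶜ c →
                 T (ok (colour d 0F 1F) (colour d 1F 2F) (colour d 0F 2F))
    ok-pattern {d = d} e
      rewrite sym (_⊑ᶜ_.preserves e 0F 1F) | sym (_⊑ᶜ_.preserves e 1F 2F) | sym (_⊑ᶜ_.preserves e 0F 2F) =
      good _ _ _ (λ eq → contradiction (_⊑ᶜ_.injective e eq) λ ())
                 (λ eq → contradiction (_⊑ᶜ_.injective e eq) λ ())
                 (λ eq → contradiction (_⊑ᶜ_.injective e eq) λ ())
    impossible : ∀ {k} {H : Graph (Fin k)} {d : Colouring H} → MonochromaticOr ʳᵇᵇK₃ d → ¬ (d ⊑ᶜ c)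
    -- On each of the five patterns `ok` evaluates to `false`, so `ok-pattern e` is itself the
    -- contradiction.
    impossible is-ᵇP₃ e = ok-pattern e
    impossible is-ʳP₃ e = ok-pattern e
    impossible is-ᵇK₃ e = ok-pattern e
    impossible is-ʳK₃ e = ok-pattern e
    impossible is-t   e = ok-pattern e

  module _ {u v w : V} (u≢v : u ≢ v) (v≢w : v ≢ w) (u≢w : u ≢ w) where

    triple⊑ : {H : Graph (Fin 3)} (d : Colouring H) → colour c u v ≡ colour d 0F 1F →
              colour c v w ≡ colour d 1F 2F → colour c u w ≡ colour d 0F 2F → d ⊑ᶜ c
    triple⊑ d uv vw uw = record
      { embed     = f
      ; injective = λ {i} {j} → inj i j
      ; preserves = λ where
          0F 0F → loop 0F
          0F 1F → uv
          0F 2F → uw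
          1F 0F → back uv
          1F 1F → loop 1F
          1F 2F → vw
          2F 0F → back uw
          2F 1F → back vw
          2F 2F → loop 2F
      }
      where
      f : Fin 3 → V
      f = lookup (u ∷ v ∷ w ∷ [])
      inj : ∀ i j → f i ≡ f j → i ≡ j
      inj 0F 0F _  = refl
      inj 0F 1F eq = contradiction eq u≢v
      inj 0F 2F eq = contradiction eq u≢w
      inj 1F 0F eq = contradiction (sym eq) u≢v
      inj 1F 1F _  = refl
      inj 1F 2F eq = contradiction eq v≢w
      inj 2F 0F eq = contradiction (sym eq) u≢w
      inj 2F 1F eq = contradiction (sym eq) v≢w
      inj 2F 2F _  = refl
      loop : ∀ i → colour c (f i) (f i) ≡ colour d i i
      loop i = trans (colour-loop c (f i)) (sym (colour-loop d i))
      back : ∀ {x y i j} → colour c x y ≡ colour d i j → colour c y x ≡ colour d j i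
      back {i = i} {j} eq = trans (colour-sym c _ _) (trans eq (colour-sym d i j))

  Free⇒Good : FreeColouring (MonochromaticOr ʳᵇᵇK₃) c → Good c
  Free⇒Good free u v w u≢v v≢w u≢w = triple (colour c u v) (colour c v w) (colour c u w) refl refl refl
    where
    v≢u : v ≢ u
    v≢u = u≢v ∘ sym
    w≢v : w ≢ v
    w≢v = v≢w ∘ sym
    w≢u : w ≢ u
    w≢u = u≢w ∘ sym
    back : ∀ {x y z} → colour c x y ≡ z → colour c y x ≡ z
    back eq = trans (colour-sym c _ _) eq

    -- The vertices are permuted to fit the pattern: the middle of a `P₃` comes second, the common
    -- end of the two blue edges of `ʳᵇᵇK₃` comes first.
    triple : ∀ x y z → colour c u v ≡ x → colour c v w ≡ y → colour c u w ≡ z → T (ok x y z)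
    triple nothing     nothing     nothing     _ _ _ = tt
    triple nothing     nothing     (just red)  _ _ _ = tt
    triple nothing     nothing     (just blue) _ _ _ = tt
    triple nothing     (just red)  nothing     _ _ _ = tt
    triple nothing     (just red)  (just red)  p q r = free is-ʳP₃ (triple⊑ u≢w w≢v u≢v ʳP₃ r (back q) p)
    triple nothing     (just red)  (just blue) _ _ _ = tt
    triple nothing     (just blue) nothing     _ _ _ = tt
    triple nothing     (just blue) (just red)  _ _ _ = tt
    triple nothing     (just blue) (just blue) p q r = free is-ᵇP₃ (triple⊑ u≢w w≢v u≢v ᵇP₃ r (back q) p)
    triple (just red)  nothing     nothing     _ _ _ = tt
    triple (just red)  nothing     (just red)  p q r = free is-ʳP₃ (triple⊑ v≢u u≢w v≢w ʳP₃ (back p) r q)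
    triple (just red)  nothing     (just blue) _ _ _ = tt
    triple (just red)  (just red)  nothing     p q r = free is-ʳP₃ (triple⊑ u≢v v≢w u≢w ʳP₃ p q r)
    triple (just red)  (just red)  (just red)  p q r = free is-ʳK₃ (triple⊑ u≢v v≢w u≢w ʳK₃ p q r)
    triple (just red)  (just red)  (just blue) _ _ _ = tt
    triple (just red)  (just blue) nothing     _ _ _ = tt
    triple (just red)  (just blue) (just red)  _ _ _ = tt
    triple (just red)  (just blue) (just blue) p q r = free is-t (triple⊑ w≢u u≢v w≢v ʳᵇᵇK₃ (back r) p (back q))
    triple (just blue) nothing     nothing     _ _ _ = tt
    triple (just blue) nothing     (just red)  _ _ _ = tt
    triple (just blue) nothing     (just blue) p q r = free is-ᵇP₃ (triple⊑ v≢u u≢w v≢w ᵇP₃ (back p) r q)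
    triple (just blue) (just red)  nothing     _ _ _ = tt
    triple (just blue) (just red)  (just red)  _ _ _ = tt
    triple (just blue) (just red)  (just blue) p q r = free is-t (triple⊑ u≢v v≢w u≢w ʳᵇᵇK₃ p q r)
    triple (just blue) (just blue) nothing     p q r = free is-ᵇP₃ (triple⊑ u≢v v≢w u≢w ᵇP₃ p q r)
    triple (just blue) (just blue) (just red)  p q r = free is-t (triple⊑ v≢u u≢w v≢w ʳᵇᵇK₃ (back p) r q)
    triple (just blue) (just blue) (just blue) p q r = free is-ᵇK₃ (triple⊑ u≢v v≢w u≢w ᵇK₃ p q r)

-- Exchanging the two colours

_≟ᶜ_ : (x y : Maybe Colour) → Dec (x ≡ y)
_≟ᶜ_ = Maybe.≡-dec λ where
  red  red  → yes refl
  red  blue → no λ ()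
  blue red  → no λ ()
  blue blue → yes refl

Exchanged : {H : Graph (Fin k)} (d e : Colouring H) → Set
Exchanged d e = ∀ u v → Maybe.map flip (colour d u v) ≡ colour e u v

exchanged? : {H : Graph (Fin k)} (d e : Colouring H) → Dec (Exchanged d e)
exchanged? d e = all? λ u → all? λ v → Maybe.map flip (colour d u v) ≟ᶜ colour e u v

module _ {G : Graph V} (c : Colouring G) where

  exchange : Colouring G
  exchange = record
    { colour     = λ u v → Maybe.map flip (colour c u v)
    ; colour-sym = λ u v → cong (Maybe.map flip) (colour-sym c u v)
    ; colour-adj = λ u v → trans (is-just-map (colour c u v)) (colour-adj c u v)
    }
    where
    is-just-map : ∀ x → is-just (Maybe.map flip x) ≡ is-just x
    is-just-map nothing  = refl
    is-just-map (just _) = refl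

  ⊑ᶜ-exchange : {H : Graph (Fin k)} {d e : Colouring H} → Exchanged d e → d ⊑ᶜ exchange → e ⊑ᶜ c
  ⊑ᶜ-exchange {d = d} {e} ex d⊑ = record
    { embed     = _⊑ᶜ_.embed d⊑
    ; injective = _⊑ᶜ_.injective d⊑
    ; preserves = λ u v → let x = colour c (_⊑ᶜ_.embed d⊑ u) (_⊑ᶜ_.embed d⊑ v) in begin
        x                                     ≡⟨ map-flip-flip x ⟨
        Maybe.map flip (Maybe.map flip x)     ≡⟨ cong (Maybe.map flip) (_⊑ᶜ_.preserves d⊑ u v) ⟩
        Maybe.map flip (colour d u v)         ≡⟨ ex u v ⟩
        colour e u v                          ∎
    }
    where
    open ≡-Reasoning
    map-flip-flip : ∀ x → Maybe.map flip (Maybe.map flip x) ≡ x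
    map-flip-flip nothing  = refl
    map-flip-flip (just x) = cong just (flip-flip x)

  exchange-free : (t t′ : Colouring (complete 3)) → Exchanged t t′ →
    FreeColouring (MonochromaticOr t′) c → FreeColouring (MonochromaticOr t) exchange
  exchange-free t t′ ex free is-ᵇP₃ = free is-ʳP₃ ∘ ⊑ᶜ-exchange (from-yes (exchanged? ᵇP₃ ʳP₃))
  exchange-free t t′ ex free is-ʳP₃ = free is-ᵇP₃ ∘ ⊑ᶜ-exchange (from-yes (exchanged? ʳP₃ ᵇP₃))
  exchange-free t t′ ex free is-ᵇK₃ = free is-ʳK₃ ∘ ⊑ᶜ-exchange (from-yes (exchanged? ᵇK₃ ʳK₃))
  exchange-free t t′ ex free is-ʳK₃ = free is-ᵇK₃ ∘ ⊑ᶜ-exchange (from-yes (exchanged? ʳK₃ ᵇK₃))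
  exchange-free t t′ ex free is-t   = free is-t ∘ ⊑ᶜ-exchange ex

HasColouring : Colouring (complete 3) → Graph V → Set
HasColouring t G = ∃ λ (c : Colouring G) → FreeColouring (MonochromaticOr t) c

exchange-⇔ : (G : Graph V) → HasColouring ʳᵇᵇK₃ G ⇔ HasColouring ʳʳᵇK₃ G
exchange-⇔ G = mk⇔
  (λ (c , free) → exchange c , exchange-free c ʳʳᵇK₃ ʳᵇᵇK₃ (from-yes (exchanged? ʳʳᵇK₃ ʳᵇᵇK₃)) free)
  (λ (c , free) → exchange c , exchange-free c ʳᵇᵇK₃ ʳʳᵇK₃ (from-yes (exchanged? ʳᵇᵇK₃ ʳʳᵇK₃)) free)

-- Forbidden graphs have no good colouring

-- every b p: p holds for all possible colours of a pair with adjacency b.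
every : Bool → (Maybe Colour → Bool) → Bool
every false p = p nothing
every true  p = p (just red) ∧ p (just blue)

every-sound : ∀ b p → T (every b p) → ∀ x → is-just x ≡ b → T (p x)
every-sound false p t nothing     _ = t
every-sound true  p t (just red)  _ = proj₁ (Equivalence.to Bool.T-∧ t)
every-sound true  p t (just blue) _ = proj₂ (Equivalence.to (Bool.T-∧ {p (just red)}) t)

infixr 4 _⇒_

_⇒_ : Bool → Bool → Bool
x ⇒ y = not x ∨ y

⇒-sound : ∀ {x y} → T (x ⇒ y) → T x → T y
⇒-sound {true} t _ = t

-- A backtracking search. Each triple is tested soon after its third pair is coloured, and a failing
-- test makes the implication true at once, which cuts the branch. A colouring surviving all ten
-- tests reaches the final `false`.
uncolourable₅ : Graph (Fin 5) → Bool
uncolourable₅ H =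
  every (adj H 0F 1F) λ a → every (adj H 0F 2F) λ b → every (adj H 1F 2F) λ c → ok a c b ⇒
  every (adj H 0F 3F) λ d → every (adj H 1F 3F) λ e → ok a e d ⇒
  every (adj H 2F 3F) λ f → ok b f d ⇒ ok c f e ⇒
  every (adj H 0F 4F) λ g → every (adj H 1F 4F) λ h → ok a h g ⇒
  every (adj H 2F 4F) λ i → ok b i g ⇒ ok c i h ⇒
  every (adj H 3F 4F) λ j → ok d j g ⇒ ok e j h ⇒ ok f j i ⇒ false

-- Replays the search along the branch given by `c`: `edge` selects the actual colour of a pair,
-- `triple` discharges a test by goodness, and what remains is `T false`.
uncolourable₅-sound : (H : Graph (Fin 5)) → T (uncolourable₅ H) → (c : Colouring H) → ¬ Good c
uncolourable₅-sound H t c good =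
  t |> edge 0F 1F |> edge 0F 2F |> edge 1F 2F |> triple 0F 1F 2F
    |> edge 0F 3F |> edge 1F 3F |> triple 0F 1F 3F
    |> edge 2F 3F |> triple 0F 2F 3F |> triple 1F 2F 3F
    |> edge 0F 4F |> edge 1F 4F |> triple 0F 1F 4F
    |> edge 2F 4F |> triple 0F 2F 4F |> triple 1F 2F 4F
    |> edge 3F 4F |> triple 0F 3F 4F |> triple 1F 3F 4F |> triple 2F 3F 4F
  where
  edge : ∀ u v {p} → T (every (adj H u v) p) → T (p (colour c u v))
  edge u v {p} t = every-sound (adj H u v) p t (colour c u v) (colour-adj c u v)

  triple : ∀ u v w {u≢v : False (u ≟ v)} {v≢w : False (v ≟ w)} {u≢w : False (u ≟ w)} {x} →
           T (ok (colour c u v) (colour c v w) (colour c u w) ⇒ x) → T x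
  triple u v w {u≢v} {v≢w} {u≢w} t =
    ⇒-sound t (good u v w (toWitnessFalse u≢v) (toWitnessFalse v≢w) (toWitnessFalse u≢w))

flip-≢ : ∀ x → flip x ≢ x
flip-≢ red  ()
flip-≢ blue ()

module _ {G : Graph V} (c : Colouring G) (good : Good c) where

  -- `ok` rejects an induced path with equal colours. Non-adjacency does not give `u ≢ w`, since
  -- `adj` is false on the diagonal.
  alternate : ∀ {u v w x} → colour c u v ≡ just x → adj G v w ≡ true → adj G u w ≡ false → u ≢ w →
              colour c v w ≡ just (flip x)
  alternate {u} {v} {w} {x} uv vw uw u≢w = trans vw≡y (cong just (differ x y ok-path))
    where
    y : Colour
    y = proj₁ (colour-adjacent c vw)
    vw≡y : colour c v w ≡ just y
    vw≡y = proj₂ (colour-adjacent c vw)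
    u≢v : u ≢ v
    u≢v refl = contradiction (trans (sym (colour-loop c u)) uv) λ ()
    ok-path : T (ok (just x) (just y) nothing)
    ok-path = subst₂ (λ p q → T (ok p (just y) q)) uv (colour-nonadjacent c uw)
      (subst (λ q → T (ok (colour c u v) q (colour c u w))) vw≡y
        (good u v w u≢v (Adj⇒≢ G (≡true⇒T vw)) u≢w))
    differ : ∀ x y → T (ok (just x) (just y) nothing) → y ≡ flip x
    differ red  blue _ = refl
    differ blue red  _ = refl

  -- Both edges of the triangle at v differ from the pendant edge vy.
  pendant-red : ∀ {u v w y} → adj G u v ≡ true → adj G v w ≡ true → adj G u w ≡ true →
                adj G v y ≡ true → adj G u y ≡ false → adj G w y ≡ false → u ≢ y → w ≢ y →
                colour c u v ≡ just red
  pendant-red {u} {v} {w} {y} uv vw uw vy uy wy u≢y w≢y =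
    trans eq-uv (cong just (red-twice _ _ ok-triangle))
    where
    x : Colour
    x = proj₁ (colour-adjacent c uv)
    eq-uv : colour c u v ≡ just x
    eq-uv = proj₂ (colour-adjacent c uv)
    z : Colour
    z = proj₁ (colour-adjacent c uw)
    eq-wv : colour c w v ≡ just x
    eq-wv with colour-adjacent c (trans (adj-sym G w v) vw)
    ... | x′ , eq = trans eq (cong just (flip-injective (Maybe.just-injective
      (trans (sym (alternate eq vy wy w≢y)) (alternate eq-uv vy uy u≢y)))))
      where
      flip-injective : ∀ {x y} → flip x ≡ flip y → x ≡ y
      flip-injective eq = trans (sym (flip-flip _)) (trans (cong flip eq) (flip-flip _))
    -- A good triangle has just one blue edge, so two edges of equal colour are red.
    ok-triangle : T (ok (just x) (just x) (just z))
    ok-triangle = subst₂ (λ p q → T (ok p (just x) q)) eq-uv (proj₂ (colour-adjacent c uw))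
      (subst (λ q → T (ok (colour c u v) q (colour c u w))) (trans (colour-sym c v w) eq-wv)
        (good u v w (Adj⇒≢ G (≡true⇒T uv)) (Adj⇒≢ G (≡true⇒T vw)) (Adj⇒≢ G (≡true⇒T uw))))
    red-twice : ∀ x z → T (ok (just x) (just x) (just z)) → x ≡ red
    red-twice red _ _ = refl
    red-twice blue red ()
    red-twice blue blue ()

  pendant-blue : ∀ {u v w y} → adj G u v ≡ true → adj G v w ≡ true → adj G u w ≡ true →
                 adj G v y ≡ true → adj G u y ≡ false → adj G w y ≡ false → u ≢ y → w ≢ y →
                 colour c v y ≡ just blue
  pendant-blue uv vw uw vy uy wy u≢y w≢y =
    alternate (pendant-red uv vw uw vy uy wy u≢y w≢y) vy uy u≢y

-- The edges to leaves 2 and 3 both differ from the edge to leaf 1, yet must differ from each other.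
claw-uncolourable : (c : Colouring claw) → ¬ Good c
claw-uncolourable c good = flip-≢ (flip x) (Maybe.just-injective (trans (sym 0-3′) 0-3))
  where
  x : Colour
  x = proj₁ (colour-adjacent c {1F} {0F} refl)
  1-0 : colour c 1F 0F ≡ just x
  1-0 = proj₂ (colour-adjacent c {1F} {0F} refl)
  0-3 : colour c 0F 3F ≡ just (flip x)
  0-3 = alternate c good 1-0 refl refl λ ()
  0-3′ : colour c 0F 3F ≡ just (flip (flip x))
  0-3′ = alternate c good (trans (colour-sym c 2F 0F) (alternate c good 1-0 refl refl λ ())) refl refl λ ()

flips : ℕ → Colour → Colour
flips zero    x = x
flips (suc j) x = flip (flips j x)

flips-even : ∀ m x → flips (2 * m) x ≡ x
flips-even zero    x = refl
flips-even (suc m) x rewrite ℕ.+-suc m (m + 0) = trans (flip-flip _) (flips-even m x)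

-- The edge 10 of `H` followed by the tail is an induced path, so every tail edge contributes one
-- flip.
grow-alternates : (H : Graph (Fin (2 + h))) → ∀ j (c : Colouring (grow H j)) → Good c →
  ∀ {x} → colour c (anchor j 1F) (anchor j 0F) ≡ just x → colour c 1F 0F ≡ just (flips j x)
grow-alternates H zero    c good eq = eq
grow-alternates H (suc j) c good eq =
  alternate c good (grow-alternates H j (pullback old c) (pullback-good old c good) eq) refl refl λ ()
  where
  old : grow H j ⊑ grow H (suc j)
  old = ⊑+vertex (grow H j) ⁅ 0F ⁆

module _ (j : ℕ) (c : Colouring (closedPath (suc j))) (good : Good c) where

  private
    first last penultimate : Fin (3 + (suc j + 0))
    first       = 1F
    last        = suc (anchor (suc j) 1F)
    penultimate = suc (anchor (suc j) 0F)

    anchor≢0 : anchor j 1F ≢ 0F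
    anchor≢0 eq = contradiction (trans (sym (anchor-last j)) eq) λ ()

    0-last : adj (closedPath (suc j)) 0F last ≡ true
    0-last = trans (cong (lookup (ends (suc j))) (anchor-last (suc j))) (lookup-⁅⁆-≡ (fromℕ (suc j + 0)))

    0-penultimate : adj (closedPath (suc j)) 0F penultimate ≡ false
    0-penultimate = lookup-⁅⁆-≢ λ eq → contradiction (anchor-injective j (trans eq (sym (anchor-last j)))) λ ()

    last-penultimate : adj (closedPath (suc j)) last penultimate ≡ true
    last-penultimate = adj-anchor K₂ (suc j) 1F 0F

  -- Going once round this cycle of length `4 + j` returns to the first edge after `4 + j` flips.
  -- Since there are at least four vertices, any three consecutive ones induce a path.
  closedPath-colour : ∃ λ x → flips (4 + j) x ≡ x
  closedPath-colour = x , Maybe.just-injective (trans (sym last-penultimate′) eq-x)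
    where
    old : grow K₂ (suc j) ⊑ closedPath (suc j)
    old = ⊑+vertex (grow K₂ (suc j)) (ends (suc j))
    x : Colour
    x = proj₁ (colour-adjacent c last-penultimate)
    eq-x : colour c last penultimate ≡ just x
    eq-x = proj₂ (colour-adjacent c last-penultimate)
    2-first : colour c 2F first ≡ just (flips (1 + j) x)
    2-first = grow-alternates K₂ (suc j) (pullback old c) (pullback-good old c good) eq-x
    first-0 : colour c first 0F ≡ just (flips (2 + j) x)
    first-0 = alternate c good 2-first refl refl λ ()
    0-last′ : colour c 0F last ≡ just (flips (3 + j) x)
    0-last′ = alternate c good first-0 0-last (lookup-⁅⁆-≢ anchor≢0) λ ()
    last-penultimate′ : colour c last penultimate ≡ just (flips (4 + j) x)
    last-penultimate′ = alternate c good 0-last′ last-penultimate 0-penultimate λ ()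

closedPath-uncolourable : ∀ m (c : Colouring (closedPath (2 * suc m))) → ¬ Good c
-- The argument is the predecessor of `2 * suc m` in unfolded form, so the cycle length
-- `3 + 2 * suc m` is odd and all its flips amount to one.
closedPath-uncolourable m c good with closedPath-colour (m + suc (m + 0)) c good
... | x , eq = flip-≢ x (begin
  flip x                                    ≡⟨ cong flip (flips-even (suc m) x) ⟨
  flip (flips (2 * suc m) x)                ≡⟨ flip-flip _ ⟨
  flip (flip (flip (flips (2 * suc m) x)))  ≡⟨ eq ⟩
  x                                         ∎)
  where open ≡-Reasoning

-- Once the tail is cut down to its first edge, `pendant-red` applies at the vertex that carries it.
grow-K₃-base-red : ∀ j (c : Colouring (grow K₃ (suc j))) → Good c →
                   colour c (anchor (suc j) 1F) (anchor (suc j) 0F) ≡ just red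
grow-K₃-base-red zero    c good =
  pendant-red c good {w = 3F} {0F} refl refl refl refl refl refl (λ ()) (λ ())
grow-K₃-base-red (suc j) c good = grow-K₃-base-red j (pullback old c) (pullback-good old c good)
  where
  old : grow K₃ (suc j) ⊑ grow K₃ (suc (suc j))
  old = ⊑+vertex (grow K₃ (suc j)) ⁅ 0F ⁆

-- The edge 23 is pendant at the triangle 012, hence blue. Coming from the other triangle, it is
-- reached from a red triangle edge by an even number of flips, hence red; for `m = 0` it is that
-- triangle edge.
twoTriangles-uncolourable : ∀ m (c : Colouring (twoTriangles (2 * m))) → ¬ Good c
twoTriangles-uncolourable m c good = contradiction (trans (sym 2-3-blue) 2-3-red) λ ()
  where
  j : ℕ
  j = 2 * m
  stem : grow K₃ (suc j) ⊑ twoTriangles j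
  stem = ⊑+vertex (grow K₃ (suc j)) (true ∷ true ∷ ∅)
  old : grow K₃ j ⊑ twoTriangles j
  old = ⊑-trans (⊑+vertex (grow K₃ j) ⁅ 0F ⁆) stem
  2-3-red : colour c 2F 3F ≡ just red
  2-3-red = begin
    colour c 2F 3F      ≡⟨ colour-sym c 2F 3F ⟩
    colour c 3F 2F      ≡⟨ grow-alternates K₃ j (pullback old c) (pullback-good old c good)
                             (grow-K₃-base-red j (pullback stem c) (pullback-good stem c good)) ⟩
    just (flips j red)  ≡⟨ cong just (flips-even m red) ⟩
    just red            ∎
    where open ≡-Reasoning
  2-3-blue : colour c 2F 3F ≡ just blue
  2-3-blue = pendant-blue c good {u = 0F} {w = 1F} refl refl refl
    (adj-grow-01 K₃ refl j) refl refl (λ ()) (λ ())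

uncolourable : {H : Graph (Fin k)} → ForbiddenGraph H → (c : Colouring H) → ¬ Good c
uncolourable is-K₅   = uncolourable₅-sound (complete 5) _
uncolourable is-claw = claw-uncolourable
uncolourable is-house = uncolourable₅-sound house _
uncolourable is-bull = uncolourable₅-sound bull _
uncolourable is-K₄+l = uncolourable₅-sound K₄+l _
uncolourable is-kite = uncolourable₅-sound kite _
uncolourable is-X₁ = uncolourable₅-sound X₁ _
uncolourable is-X₂ = uncolourable₅-sound X₂ _
uncolourable is-K₅-e = uncolourable₅-sound K₅-e _
uncolourable is-gem = uncolourable₅-sound gem _
uncolourable is-4-wheel = uncolourable₅-sound 4-wheel _
uncolourable (is-odd-hole (suc (suc m)) _) c good =
  closedPath-uncolourable m (pullback e c) (pullback-good e c good)
  where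
  e : closedPath (2 * suc m) ⊑ cycle (2 * suc (suc m) + 1)
  e = subst (λ n → closedPath (2 * suc m) ⊑ cycle n) (size m) (closedPath⊑cycle (2 * suc m))
    where
    open import Data.Nat.Tactic.RingSolver using (solve-∀)
    size : ∀ m → 3 + 2 * suc m ≡ 2 * suc (suc m) + 1
    size = solve-∀
uncolourable (is-odd-hole 1 (s≤s ()))
uncolourable (is-even-butterfly m) c good =
  twoTriangles-uncolourable m (pullback e c) (pullback-good e c good)
  where
  e : twoTriangles (2 * m) ⊑ butterfly (2 * m)
  e = twoTriangles⊑butterfly (2 * m)

Good⇒Free-Forbidden : {G : Graph V} (c : Colouring G) → Good c → Free ForbiddenGraph G
Good⇒Free-Forbidden c good F H⊑G = uncolourable F (pullback H⊑G c) (pullback-good H⊑G c good)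

-- Good colourings of even cycles and odd butterflies

good? : {G : Graph (Fin n)} (c : Colouring G) → Dec (Good c)
good? c = all? λ u → all? λ v → all? λ w →
  ¬? (u ≟ v) →-dec ¬? (v ≟ w) →-dec ¬? (u ≟ w) →-dec T? (ok (colour c u v) (colour c v w) (colour c u w))

-- The blue edges are among 02 and 13.
twoBlue : (G : Graph (Fin 4)) → Colouring G
twoBlue G = paint G (λ u v → if diagonal u v ∨ diagonal v u then blue else red)
                    (λ u v → cong (λ b → if b then blue else red) (Bool.∨-comm (diagonal u v) (diagonal v u)))
  where
  diagonal : Fin 4 → Fin 4 → Bool
  diagonal u v = 2 + toℕ u ≡ᵇ toℕ v

twoBlue-K₄-good : Good (twoBlue (complete 4))
twoBlue-K₄-good = from-yes (good? (twoBlue (complete 4)))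

twoBlue-diamond-good : Good (twoBlue diamond)
twoBlue-diamond-good = from-yes (good? (twoBlue diamond))

ok-reverse : ∀ x y z → T (ok x y z) → T (ok z y x)
ok-reverse x y z t = ok-swapˡ y z x (ok-swapʳ y x z (ok-swapˡ x y z t))

module _ {G : Graph (Fin n)} (S : Subset n) (row : Fin n → Maybe Colour)
         (row-S : ∀ v → is-just (row v) ≡ lookup S v) (c : Colouring G) where

  +vertex-colouring : Colouring (G +vertex S)
  +vertex-colouring = record { colour = f ; colour-sym = f-sym ; colour-adj = f-adj }
    where
    f : Fin (suc n) → Fin (suc n) → Maybe Colour
    f zero    zero    = nothing
    f zero    (suc v) = row v
    f (suc u) zero    = row u
    f (suc u) (suc v) = colour c u v
    f-sym : ∀ u v → f u v ≡ f v u
    f-sym zero    zero    = refl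
    f-sym zero    (suc v) = refl
    f-sym (suc u) zero    = refl
    f-sym (suc u) (suc v) = colour-sym c u v
    f-adj : ∀ u v → is-just (f u v) ≡ adj (G +vertex S) u v
    f-adj zero    zero    = refl
    f-adj zero    (suc v) = row-S v
    f-adj (suc u) zero    = row-S u
    f-adj (suc u) (suc v) = colour-adj c u v

  -- Only the triples through the new vertex need checking, and the symmetry of `ok` lets the other
  -- two vertices be ordered.
  +vertex-good : Good c → (∀ {u v} → u < v → T (ok (row u) (colour c u v) (row v))) → Good +vertex-colouring
  +vertex-good good row-ok = all-ok
    where
    row-ok′ : ∀ u v → u ≢ v → T (ok (row u) (colour c u v) (row v))
    row-ok′ u v u≢v with <-cmp u v
    ... | tri< u<v _ _ = row-ok u<v
    ... | tri≈ _ u≡v _ = contradiction u≡v u≢v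
    ... | tri> _ _ v<u = ok-reverse (row v) (colour c u v) (row u)
      (subst (λ x → T (ok (row v) x (row u))) (colour-sym c v u) (row-ok v<u))
    all-ok : Good +vertex-colouring
    all-ok zero    zero    w       0≢0 _ _ = contradiction refl 0≢0
    all-ok zero    (suc v) zero    _ _ 0≢0 = contradiction refl 0≢0
    all-ok zero    (suc v) (suc w) _ v≢w _ = row-ok′ v w (v≢w ∘ cong suc)
    all-ok (suc u) zero    zero    _ 0≢0 _ = contradiction refl 0≢0
    all-ok (suc u) zero    (suc w) _ _ u≢w =
      ok-swapʳ (row u) (colour c u w) (row w) (row-ok′ u w (u≢w ∘ cong suc))
    all-ok (suc u) (suc v) zero    u≢v _ _ =
      ok-swapʳ (colour c u v) (row u) (row v)
        (ok-swapˡ (row u) (colour c u v) (row v) (row-ok′ u v (u≢v ∘ cong suc)))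
    all-ok (suc u) (suc v) (suc w) u≢v v≢w u≢w =
      good u v w (u≢v ∘ cong suc) (v≢w ∘ cong suc) (u≢w ∘ cong suc)

-- The invariant of growth: a vertex with all its edges of colour `x` accepts a pendant edge of
-- colour `flip x`, and the new end is again uniform.
Uniform : {G : Graph V} → Colouring G → V → Colour → Set
Uniform c v x = ∀ u → colour c v u ≡ nothing ⊎ colour c v u ≡ just x

pendantRow : Colour → Fin (suc n) → Maybe Colour
pendantRow x zero    = just x
pendantRow x (suc _) = nothing

pendantRow-⁅0⁆ : ∀ x (v : Fin (suc n)) → is-just (pendantRow x v) ≡ lookup ⁅ 0F ⁆ v
pendantRow-⁅0⁆ x zero    = refl
pendantRow-⁅0⁆ x (suc v) = sym (lookup-∅ v)

pendant : {G : Graph (Fin (suc n))} → Colour → Colouring G → Colouring (G +vertex ⁅ 0F ⁆)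
pendant x = +vertex-colouring ⁅ 0F ⁆ (pendantRow x) (pendantRow-⁅0⁆ x)

ok-flip : ∀ x {y} → y ≡ nothing ⊎ y ≡ just x → T (ok (just (flip x)) y nothing)
ok-flip red  (inj₁ refl) = tt
ok-flip red  (inj₂ refl) = tt
ok-flip blue (inj₁ refl) = tt
ok-flip blue (inj₂ refl) = tt

ok-single : ∀ x → T (ok nothing x nothing)
ok-single nothing     = tt
ok-single (just red)  = tt
ok-single (just blue) = tt

module _ {G : Graph (Fin (suc n))} {c : Colouring G} {x : Colour} where

  pendant-good : Good c → Uniform c 0F x → Good (pendant (flip x) c)
  pendant-good good uniform = +vertex-good ⁅ 0F ⁆ (pendantRow (flip x)) (pendantRow-⁅0⁆ (flip x)) c good row-ok
    where
    row-ok : ∀ {u v} → u < v → T (ok (pendantRow (flip x) u) (colour c u v) (pendantRow (flip x) v))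
    row-ok {zero}  {suc v} _ = ok-flip x (uniform (suc v))
    row-ok {suc u} {suc v} _ = ok-single _

pendant-uniform : {G : Graph (Fin (suc n))} (c : Colouring G) → ∀ x → Uniform (pendant x c) 0F x
pendant-uniform c x 0F            = inj₁ refl
pendant-uniform c x 1F            = inj₂ refl
pendant-uniform c x (suc (suc u)) = inj₁ refl

pendant-uniform-suc : {G : Graph (Fin (suc n))} (c : Colouring G) → ∀ x {v y} →
  Uniform c (suc v) y → Uniform (pendant x c) (suc (suc v)) y
pendant-uniform-suc c x uniform zero    = inj₁ refl
pendant-uniform-suc c x uniform (suc u) = uniform u

growColouring : {H : Graph (Fin (2 + h))} → Colouring H → Colour → ∀ j → Colouring (grow H j)
growColouring c x zero    = c
growColouring c x (suc j) = pendant (flips (suc j) x) (growColouring c x j)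

module _ {H : Graph (Fin (2 + h))} {c : Colouring H} {x : Colour} where

  grow-uniform : Uniform c 0F x → ∀ j → Uniform (growColouring c x j) 0F (flips j x)
  grow-uniform uniform zero    = uniform
  grow-uniform uniform (suc j) = pendant-uniform (growColouring c x j) (flips (suc j) x)

  grow-good : Good c → Uniform c 0F x → ∀ j → Good (growColouring c x j)
  grow-good good uniform zero    = good
  grow-good good uniform (suc j) = pendant-good (grow-good good uniform j) (grow-uniform uniform j)

  grow-uniform-last : ∀ {y} → Uniform c (fromℕ (suc h)) y →
                      ∀ j → Uniform (growColouring c x j) (fromℕ (suc (j + h))) y
  grow-uniform-last uniform zero    = uniform
  grow-uniform-last uniform (suc j) =
    pendant-uniform-suc (growColouring c x j) (flips (suc j) x) (grow-uniform-last uniform j)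

redEdge : Colouring K₂
redEdge = monochromatic K₂ red

redEdge-uniform : ∀ v → Uniform redEdge v red
redEdge-uniform 0F 0F = inj₁ refl
redEdge-uniform 0F 1F = inj₂ refl
redEdge-uniform 1F 0F = inj₂ refl
redEdge-uniform 1F 1F = inj₁ refl

Colourable : Graph V → Set
Colourable G = ∃ λ (c : Colouring G) → Good c

Colourable-⊒ : {H : Graph U} {G : Graph V} → H ⊑ G → Colourable G → Colourable H
Colourable-⊒ e (c , good) = pullback e c , pullback-good e c good

-- The path `grow K₂ j` has an even number `1 + j` of edges, so its end edges differ. The two edges
-- at the new vertex take the opposite colours and hence differ as well.
closedPath-colourable : ∀ m → Colourable (closedPath (1 + 2 * m))
closedPath-colourable m = +vertex-colouring (ends j) row row-ends stem ,
  +vertex-good (ends j) row row-ends stem good row-ok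
  where
  j : ℕ
  j = 1 + 2 * m
  stem : Colouring (grow K₂ j)
  stem = growColouring redEdge red j
  good : Good stem
  good = grow-good (from-yes (good? redEdge)) (redEdge-uniform 0F) j
  uniform-first : Uniform stem 0F blue
  uniform-first = subst (Uniform stem 0F) (cong flip (flips-even m red)) (grow-uniform (redEdge-uniform 0F) j)
  uniform-last : Uniform stem (suc (fromℕ (j + 0))) red
  uniform-last = grow-uniform-last {x = red} (redEdge-uniform 1F) j
  row : Fin (2 + (j + 0)) → Maybe Colour
  row zero    = just red
  row (suc v) = if ⌊ v ≟ fromℕ (j + 0) ⌋ then just blue else nothing
  row-ends : ∀ v → is-just (row v) ≡ lookup (ends j) v
  row-ends zero    = refl
  row-ends (suc v) with v ≟ fromℕ (j + 0)
  ... | yes refl = sym (lookup-⁅⁆-≡ (fromℕ (j + 0)))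
  ... | no  v≢l  = sym (lookup-⁅⁆-≢ v≢l)
  row-ok : ∀ {u v} → u < v → T (ok (row u) (colour stem u v) (row v))
  row-ok {zero} {suc v} _ with v ≟ fromℕ (j + 0)
  -- As `j` is positive, the two ends of the path are not adjacent.
  ... | yes refl = tt
  ... | no _     = ok-flip blue (uniform-first (suc v))
  row-ok {suc u} {suc v} u<v with u ≟ fromℕ (j + 0) | v ≟ fromℕ (j + 0)
  ... | yes refl | yes refl = contradiction u<v (ℕ.<-irrefl refl)
  ... | yes refl | no _     = ok-flip red (uniform-last (suc v))
  ... | no _     | no _     = ok-single _
  ... | no _     | yes refl = ok-reverse (just blue) (colour stem (suc u) (suc v)) nothing
    (ok-flip red (subst (λ x → x ≡ nothing ⊎ x ≡ just red) (colour-sym stem (suc v) (suc u)) (uniform-last (suc u))))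

-- Both triangles have their red edges at the vertex where the path is attached. The path must then
-- begin and end in blue, as alternation over an odd length does.
twoTriangles-colourable : ∀ m → Colourable (twoTriangles (1 + 2 * m))
twoTriangles-colourable m = +vertex-colouring (true ∷ true ∷ ∅) row row-S c ,
  +vertex-good (true ∷ true ∷ ∅) row row-S c (pendant-good good uniform) row-ok
  where
  j : ℕ
  j = 1 + 2 * m
  uniform-triangle : Uniform ʳʳᵇK₃ 0F red
  uniform-triangle 0F = inj₁ refl
  uniform-triangle 1F = inj₂ refl
  uniform-triangle 2F = inj₂ refl
  stem : Colouring (grow K₃ j)
  stem = growColouring ʳʳᵇK₃ red j
  good : Good stem
  good = grow-good (from-yes (good? ʳʳᵇK₃)) uniform-triangle j
  uniform : Uniform stem 0F blue
  uniform = subst (Uniform stem 0F) (cong flip (flips-even m red)) (grow-uniform uniform-triangle j)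
  c : Colouring (grow K₃ (suc j))
  c = pendant red stem
  row : Fin (3 + (j + 1)) → Maybe Colour
  row 0F            = just blue
  row 1F            = just red
  row (suc (suc v)) = nothing
  row-S : ∀ v → is-just (row v) ≡ lookup (true ∷ true ∷ ∅) v
  row-S 0F            = refl
  row-S 1F            = refl
  row-S (suc (suc v)) = sym (lookup-∅ v)
  row-ok : ∀ {u v} → u < v → T (ok (row u) (colour c u v) (row v))
  row-ok {0F}          {1F}          _ = tt
  row-ok {0F}          {suc (suc v)} _ = tt
  row-ok {1F}          {suc (suc v)} _ = ok-flip blue (uniform (suc v))
  row-ok {1F}          {1F}          (s≤s ())
  row-ok {suc (suc u)} {1F}          (s≤s ())
  row-ok {suc (suc u)} {suc (suc v)} _ = ok-single _

cycle-colourable : ∀ m → 2 ≤ m → Colourable (cycle (2 * m))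
cycle-colourable 1             (s≤s ())
cycle-colourable (suc (suc m)) _ = Colourable-⊒ (cycle⊑closedPath (1 + 2 * m)) (closedPath-colourable m)
  |> subst (λ n → Colourable (cycle n)) (size m)
  where
  size : ∀ m → 3 + (1 + 2 * m) ≡ 2 * suc (suc m)
  size = solve-∀

butterfly-colourable : ∀ m → Colourable (butterfly (2 * m + 1))
butterfly-colourable m = subst (λ n → Colourable (butterfly n)) (ℕ.+-comm 1 (2 * m))
  (Colourable-⊒ (butterfly⊑twoTriangles (1 + 2 * m)) (twoTriangles-colourable m))

-- Colouring a graph component by component

-- Reachability is decided by Warshall's algorithm.
module Reachability (G : Graph (Fin n)) where

  -- Reach xs u v: some walk from u to v has all its interior vertices in xs.
  Reach : List (Fin n) → Fin n → Fin n → Set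
  Reach []       u v = u ≡ v ⊎ Adj G u v
  Reach (x ∷ xs) u v = Reach xs u v ⊎ (Reach xs u x × Reach xs x v)

  reach? : ∀ xs u v → Dec (Reach xs u v)
  reach? []       u v = (u ≟ v) ⊎-dec T? (adj G u v)
  reach? (x ∷ xs) u v = reach? xs u v ⊎-dec (reach? xs u x ×-dec reach? xs x v)

  reach-short : ∀ xs {u v} → u ≡ v ⊎ Adj G u v → Reach xs u v
  reach-short []       r = r
  reach-short (x ∷ xs) r = inj₁ (reach-short xs r)

  -- When both walks pass through the head of the list, the stretch between these two passages is
  -- dropped.
  reach-through : ∀ {xs x u v} → x ∈ˡ xs → Reach xs u x → Reach xs x v → Reach xs u v
  reach-through (here refl) r s = inj₂ (to-head r , from-head s)
    where
    to-head : ∀ {x xs u} → Reach (x ∷ xs) u x → Reach xs u x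
    to-head (inj₁ r)       = r
    to-head (inj₂ (r , _)) = r
    from-head : ∀ {x xs v} → Reach (x ∷ xs) x v → Reach xs x v
    from-head (inj₁ r)       = r
    from-head (inj₂ (_ , r)) = r
  reach-through (there x∈xs) (inj₁ r)       (inj₁ s)       = inj₁ (reach-through x∈xs r s)
  reach-through (there x∈xs) (inj₁ r)       (inj₂ (s , t)) = inj₂ (reach-through x∈xs r s , t)
  reach-through (there x∈xs) (inj₂ (r , s)) (inj₁ t)       = inj₂ (r , reach-through x∈xs s t)
  reach-through (there x∈xs) (inj₂ (r , _)) (inj₂ (_ , t)) = inj₂ (r , t)

  reach⇒star : ∀ xs {u v} → Reach xs u v → Star (Adj G) u v
  reach⇒star []       (inj₁ refl)    = ε
  reach⇒star []       (inj₂ uv)      = uv ◅ ε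
  reach⇒star (x ∷ xs) (inj₁ r)       = reach⇒star xs r
  reach⇒star (x ∷ xs) (inj₂ (r , s)) = reach⇒star xs r ◅◅ reach⇒star xs s

  star⇒reach : ∀ {u v} → Star (Adj G) u v → Reach (allFin n) u v
  star⇒reach ε        = reach-short (allFin n) (inj₁ refl)
  star⇒reach (e ◅ es) = reach-through (∈-allFin _) (reach-short (allFin n) (inj₂ e)) (star⇒reach es)

  star? : ∀ u v → Dec (Star (Adj G) u v)
  star? u v = map′ (reach⇒star (allFin n)) star⇒reach (reach? (allFin n) u v)

  star-sym : ∀ {u v} → Star (Adj G) u v → Star (Adj G) v u
  star-sym = Star.reverse (Adj-sym G)

  component : Fin n → Subset n
  component u = tabulate λ v → does (star? u v)

  ∈-component : ∀ {u v} → v ∈ component u ⇔ Star (Adj G) u v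
  ∈-component {u} {v} = mk⇔
    (λ v∈ → toWitness {a? = star? u v} (≡true⇒T
      (trans (isYes≗does (star? u v)) (trans (sym (lookup∘tabulate _ v)) ([]=⇒lookup v∈)))))
    (λ r → lookup⇒[]= v _ (trans (lookup∘tabulate _ v) (dec-true (star? u v) r)))

  component-isComponent : ∀ u → IsComponent G (component u)
  component-isComponent u = u , λ v → ∈-component

  component-≡ : ∀ {u v} → v ∈ component u → component v ≡ component u
  component-≡ {u} {v} v∈ = tabulate-cong λ w → does-⇔
    (mk⇔ (Equivalence.to ∈-component v∈ ◅◅_) (star-sym (Equivalence.to ∈-component v∈) ◅◅_))
    (star? v w) (star? u w)

  self-∈-component : ∀ u → u ∈ component u
  self-∈-component u = Equivalence.from ∈-component ε

module Glue (G : Graph (Fin n))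
            (colourable : ∀ S → IsComponent G S → Colourable (G [ S ])) where
  open Reachability G

  -- A decidable form of `IsComponent`. Its decision on a set supplies the argument of `colourable`,
  -- independently of the vertex from which the set was obtained.
  IsComponentOf : Subset n → Set
  IsComponentOf S = ∃ λ v → S ≡ component v

  isComponentOf? : ∀ S → Dec (IsComponentOf S)
  isComponentOf? S = any? λ v → ≡-dec Bool._≟_ S (component v)

  restricted : ∀ {S} → Colouring (G [ S ]) → ∀ x y → Dec (x ∈ S) → Dec (y ∈ S) → Maybe Colour
  restricted c x y (yes x∈S) (yes y∈S) = colour c (x , x∈S) (y , y∈S)
  restricted c x y (yes _)   (no _)    = nothing
  restricted c x y (no _)    _         = nothing

  chosen : ∀ S → IsComponentOf S → Colourable (G [ S ])
  chosen S (v , refl) = colourable S (component-isComponent v)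

  colourIn : ∀ S → Dec (IsComponentOf S) → Fin n → Fin n → Maybe Colour
  colourIn S (yes r) x y = restricted (proj₁ (chosen S r)) x y (x ∈? S) (y ∈? S)
  colourIn S (no _)  x y = nothing

  -- The colour only depends on the set component u, so all the edges of a
  -- component are coloured by the same chosen colouring.
  glued : Fin n → Fin n → Maybe Colour
  glued u v = colourIn (component u) (isComponentOf? (component u)) u v

  glued-inside : ∀ u → ∃ λ (c : Colouring (G [ component u ])) → Good c ×
    (∀ {x y} (x∈ : x ∈ component u) (y∈ : y ∈ component u) → glued x y ≡ colour c (x , x∈) (y , y∈))
  glued-inside u with isComponentOf? (component u) in eq
  ... | no ¬r = contradiction (u , refl) ¬r
  ... | yes r = proj₁ (chosen _ r) , proj₂ (chosen _ r) , λ {x} {y} x∈ y∈ → begin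
    glued x y
      ≡⟨ cong (λ S → colourIn S (isComponentOf? S) x y) (component-≡ x∈) ⟩
    colourIn (component u) (isComponentOf? (component u)) x y
      ≡⟨ cong (λ d → colourIn (component u) d x y) eq ⟩
    restricted c x y (x ∈? component u) (y ∈? component u)
      ≡⟨ restricted-∈ (x ∈? component u) (y ∈? component u) x∈ y∈ ⟩
    colour c (x , x∈) (y , y∈)
      ∎
    where
    open ≡-Reasoning
    c : Colouring (G [ component u ])
    c = proj₁ (chosen _ r)
    restricted-∈ : ∀ {x y} d d′ (x∈ : x ∈ component u) (y∈ : y ∈ component u) →
                   restricted c x y d d′ ≡ colour c (x , x∈) (y , y∈)
    restricted-∈ (yes p) (yes q) x∈ y∈ =
      cong₂ (λ p q → colour c (_ , p) (_ , q)) ([]=-irrelevant p x∈) ([]=-irrelevant q y∈)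
    restricted-∈ (yes _) (no y∉) _  y∈ = contradiction y∈ y∉
    restricted-∈ (no x∉) _       x∈ _  = contradiction x∈ x∉

  glued-outside : ∀ {u v} → ¬ v ∈ component u → glued u v ≡ nothing
  glued-outside {u} {v} v∉ with isComponentOf? (component u)
  ... | no _  = refl
  ... | yes r = restricted-∉ (u ∈? component u) (v ∈? component u)
    where
    restricted-∉ : ∀ d d′ → restricted (proj₁ (chosen _ r)) u v d d′ ≡ nothing
    restricted-∉ (yes _) (yes v∈) = contradiction v∈ v∉
    restricted-∉ (yes _) (no _)   = refl
    restricted-∉ (no _)  _        = refl

  component-sym : ∀ {u v} → v ∈ component u → u ∈ component v
  component-sym {u} v∈ = subst (u ∈_) (sym (component-≡ v∈)) (self-∈-component u)

  gluedColouring : Colouring G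
  gluedColouring = record { colour = glued ; colour-sym = glued-sym ; colour-adj = glued-adj }
    where
    glued-sym : ∀ u v → glued u v ≡ glued v u
    glued-sym u v with v ∈? component u | glued-inside u
    ... | no v∉  | _ = trans (glued-outside v∉) (sym (glued-outside (v∉ ∘ component-sym)))
    ... | yes v∈ | c , _ , inside = begin
      glued u v                          ≡⟨ inside u∈ v∈ ⟩
      colour c (u , u∈) (v , v∈)         ≡⟨ colour-sym c _ _ ⟩
      colour c (v , v∈) (u , u∈)         ≡⟨ inside v∈ u∈ ⟨
      glued v u                          ∎
      where
      open ≡-Reasoning
      u∈ : u ∈ component u
      u∈ = self-∈-component u
    glued-adj : ∀ u v → is-just (glued u v) ≡ adj G u v
    glued-adj u v with v ∈? component u | glued-inside u
    ... | no v∉  | _ = trans (cong is-just (glued-outside v∉))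
      (sym (¬T⇒≡false λ uv → v∉ (Equivalence.from ∈-component (uv ◅ ε))))
    ... | yes v∈ | c , _ , inside =
      trans (cong is-just (inside (self-∈-component u) v∈)) (colour-adj c _ _)

  glued-good : Good gluedColouring
  glued-good u v w u≢v v≢w u≢w with v ∈? component u | w ∈? component u | glued-inside u
  ... | yes v∈ | yes w∈ | c , good , inside
    rewrite inside (self-∈-component u) v∈ | inside v∈ w∈ | inside (self-∈-component u) w∈ =
    good _ _ _ (u≢v ∘ cong proj₁) (v≢w ∘ cong proj₁) (u≢w ∘ cong proj₁)
  -- From here on the triple meets more than one component and so spans at most one edge.
  ... | no v∉ | no w∉ | _ rewrite glued-outside v∉ | glued-outside w∉ = ok-single (glued v w)
  ... | yes v∈ | no w∉ | _
    rewrite glued-outside w∉ | glued-outside (subst (λ S → ¬ w ∈ S) (sym (component-≡ v∈)) w∉) =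
    ok-swapˡ nothing (glued u v) nothing (ok-single (glued u v))
  ... | no v∉ | yes w∈ | _
    rewrite glued-outside v∉
          | glued-outside (λ w∈v → v∉ (subst (v ∈_) (component-≡ w∈) (component-sym w∈v))) =
    ok-swapʳ nothing (glued u w) nothing (ok-single (glued u w))

-- Structure of the components of a graph without the forbidden subgraphs

Outer : Graph V → (a b c x : V) → Set
Outer G a b c x = x ≢ a × x ≢ b × x ≢ c × (Adj G x a ⊎ Adj G x b ⊎ Adj G x c)

ClawFree : Graph V → Set
ClawFree G = ∀ {c x y z} → Adj G c x → Adj G c y → Adj G c z → x ≢ y → x ≢ z → y ≢ z →
             Adj G x y ⊎ Adj G x z ⊎ Adj G y z

OuterUnique : Graph V → (V → Set) → Set
OuterUnique G P = ∀ {a b c x y} → P a → Adj G a b → Adj G a c → Adj G b c →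
                  Outer G a b c x → Outer G a b c y → x ≡ y

Image : {H : Graph U} {G : Graph V} → H ⊑ G → V → Set
Image e w = ∃ λ i → embed e i ≡ w

image? : {H : Graph (Fin k)} {G : Graph (Fin n)} (e : H ⊑ G) → Decidable (Image e)
image? e w = any? λ i → embed e i ≟ w

-- The induced subgraph is extended vertex by vertex at its vertex 0, keeping
-- all the allowed neighbours of the other vertices inside it.
module Walk (G : Graph (Fin n)) {Allowed : Fin n → Set} (allowed? : Decidable Allowed)
            (claw-free : ClawFree G) (outer-unique : OuterUnique G Allowed)
            (H : Graph (Fin (2 + h))) (H-01 : adj H 0F 1F ≡ true) (s : Fin n) where

  Closed : {F : Graph (Fin k)} → F ⊑ G → Set
  Closed e = ∀ i {w} → Adj G (embed e i) w → Allowed w → Image e w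

  Within : {F : Graph (Fin k)} → F ⊑ G → Set
  Within e = ∀ i → Allowed (embed e i)

  -- Only the newest vertex may still have allowed neighbours outside. `last` remembers where the
  -- walk began, which the cycle case needs for closing up.
  record State (j : ℕ) : Set where
    field
      e      : grow H j ⊑ G
      within : Within e
      closed : ∀ i {w} → Adj G (embed e (suc i)) w → Allowed w → Image e w
      last   : embed e (fromℕ (suc (j + h))) ≡ s

  data Outcome : Set where
    dead-end : ∀ j (e : grow H j ⊑ G) → Within e → Closed e →
               embed e (fromℕ (suc (j + h))) ≡ s → Outcome
    triangle-end : ∀ j (e : grow H j +vertex ⁅ 0F ⁆ +vertex (true ∷ true ∷ ∅) ⊑ G) →
               Within e → Closed e → Outcome

  module Step {j : ℕ} (state : State j) where
    open State state

    New : Fin n → Set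
    New y = Adj G (embed e 0F) y × Allowed y × ¬ Image e y

    new? : Decidable New
    new? y = T? (adj G (embed e 0F) y) ×-dec allowed? y ×-dec ¬? (image? e y)

    inside : ∀ {y} → Adj G (embed e 0F) y → Allowed y → ¬ New y → Image e y
    inside {y} 0y al ¬new = decidable-stable (image? e y) λ y∉ → ¬new (0y , al , y∉)

    not-adjacent : ∀ {y} → New y → ∀ i → ¬ Adj G y (embed e (suc i))
    not-adjacent (_ , al , y∉) i yi = y∉ (closed i (Adj-sym G yi) al)

    module _ {y : Fin n} (new : New y) where

      longer : grow H (suc j) ⊑ G
      longer = extend ⁅ 0F ⁆ e y (λ i eq → proj₂ (proj₂ new) (i , eq)) row
        where
        row : ∀ i → adj G y (embed e i) ≡ lookup ⁅ 0F ⁆ i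
        row zero    = T⇒≡true (Adj-sym G (proj₁ new))
        row (suc i) = trans (¬T⇒≡false (not-adjacent new i)) (sym (lookup-∅ i))

      longer-within : Within longer
      longer-within zero    = proj₁ (proj₂ new)
      longer-within (suc i) = within i

      extended : (∀ z → z ≢ y → ¬ New z) → State (suc j)
      extended only = record
        { e      = longer
        ; within = longer-within
        ; closed = longer-closed
        ; last   = last
        }
        where
        longer-closed : ∀ i {w} → Adj G (embed e i) w → Allowed w → Image longer w
        longer-closed zero    {w} 0w al with w ≟ y
        ... | yes refl = zero , refl
        ... | no  w≢y  with inside 0w al (only w w≢y)
        ...   | i , eq = suc i , eq
        longer-closed (suc i) iw al with closed i iw al
        ... | i′ , eq = suc i′ , eq

      module _ {z : Fin n} (z≢y : z ≢ y) (new′ : New z) where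

        0~1 : Adj G (embed e 0F) (embed e 1F)
        0~1 = ≡true⇒T (trans (preserves e 0F 1F) (adj-grow-01 H H-01 j))

        -- The allowed neighbours of vertex 1 already lie in the image, so it is adjacent to neither
        -- `y` nor `z`; only the edge `yz` prevents a claw at vertex 0.
        y-z : Adj G y z
        y-z with claw-free 0~1 (proj₁ new) (proj₁ new′) (λ eq → proj₂ (proj₂ new) (1F , eq))
                           (λ eq → proj₂ (proj₂ new′) (1F , eq)) (z≢y ∘ sym)
        ... | inj₁ 1y        = contradiction (Adj-sym G 1y) (not-adjacent new 0F)
        ... | inj₂ (inj₁ 1z) = contradiction (Adj-sym G 1z) (not-adjacent new′ 0F)
        ... | inj₂ (inj₂ yz) = yz

        closing : grow H j +vertex ⁅ 0F ⁆ +vertex (true ∷ true ∷ ∅) ⊑ G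
        closing = extend (true ∷ true ∷ ∅) longer z z∉ row
          where
          z∉ : ∀ i → embed longer i ≢ z
          z∉ zero    = z≢y ∘ sym
          z∉ (suc i) = λ eq → proj₂ (proj₂ new′) (i , eq)
          row : ∀ i → adj G z (embed longer i) ≡ lookup (true ∷ true ∷ ∅) i
          row 0F            = T⇒≡true (Adj-sym G y-z)
          row 1F            = T⇒≡true (Adj-sym G (proj₁ new′))
          row (suc (suc i)) = trans (¬T⇒≡false (not-adjacent new′ i)) (sym (lookup-∅ i))

        closing-within : Within closing
        closing-within zero    = proj₁ (proj₂ new′)
        closing-within (suc i) = longer-within i

        -- Vertex 1 is already an outer neighbour of the triangle formed by vertex 0, `y` and `z`,
        -- so by uniqueness there is no other. In `closing` it has become vertex 3.
        around : ∀ {w} → Adj G w (embed e 0F) ⊎ Adj G w y ⊎ Adj G w z → Image closing w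
        around {w} w~ with w ≟ z | w ≟ y | w ≟ embed e 0F
        ... | yes refl | _        | _        = 0F , refl
        ... | no _     | yes refl | _        = 1F , refl
        ... | no _     | no _     | yes refl = 2F , refl
        ... | no w≢z   | no w≢y   | no w≢0   = 3F , outer-unique (within 0F) (proj₁ new) (proj₁ new′) y-z
          ( Adj⇒≢ G 0~1 ∘ sym , (λ eq → proj₂ (proj₂ new) (1F , eq)) , (λ eq → proj₂ (proj₂ new′) (1F , eq))
          , inj₁ (Adj-sym G 0~1))
          (w≢0 , w≢y , w≢z , w~)

        closing-closed : Closed closing
        closing-closed 0F zw _ = around (inj₂ (inj₂ (Adj-sym G zw)))
        closing-closed 1F yw _ = around (inj₂ (inj₁ (Adj-sym G yw)))
        closing-closed 2F 0w _ = around (inj₁ (Adj-sym G 0w))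
        closing-closed (suc (suc (suc i))) iw al with closed i iw al
        ... | i′ , eq = suc (suc i′) , eq

    step : Outcome ⊎ State (suc j)
    step with any? new?
    ... | no ¬new = inj₁ (dead-end j e within all-closed last)
      where
      all-closed : Closed e
      all-closed zero    0w al = inside 0w al λ new → ¬new (_ , new)
      all-closed (suc i)       = closed i
    ... | yes (y , new) with any? (λ z → ¬? (z ≟ y) ×-dec new? z)
    ...   | no ¬new′            = inj₂ (extended new λ z z≢y new′ → ¬new′ (z , z≢y , new′))
    ...   | yes (z , z≢y , new′) =
      inj₁ (triangle-end j (closing new z≢y new′) (closing-within new z≢y new′) (closing-closed new z≢y new′))

  -- A walk has at most n vertices, so it stops before its fuel is used up.
  run : ∀ fuel j → n ≤ fuel + j → State j → Outcome
  run zero       j n≤j state =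
    contradiction (ℕ.≤-trans (injective⇒≤ (injective (State.e state))) n≤j)
                  (ℕ.<⇒≱ (ℕ.≤-trans (ℕ.m≤m+n (suc j) h) (ℕ.n≤1+n _)))
  run (suc fuel) j n≤ state with Step.step state
  ... | inj₁ outcome = outcome
  ... | inj₂ state′  = run fuel (suc j) (ℕ.≤-trans n≤ (ℕ.≤-reflexive (sym (ℕ.+-suc fuel j)))) state′

  walk : State 0 → Outcome
  walk = run n 0 (ℕ.m≤m+n n 0)

-- Vertices attached to a K₄ or a diamond

ContainsForbidden : Graph V → Set
ContainsForbidden G = ∃ λ k → Σ (Graph (Fin k)) λ H → ForbiddenGraph H × H ⊑ G

-- Four neighbours give `complete 5`, three `K₅-e`, two `X₂` and one `K₄+l`.
K₄-attached : ∀ S → S ≡ ∅ ⊎ ContainsForbidden (complete 4 +vertex S)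
K₄-attached (true  ∷ true  ∷ true  ∷ true  ∷ []) = inj₂ (_ , _ , is-K₅ , by-map (0F ∷ 1F ∷ 2F ∷ 3F ∷ 4F ∷ []))
K₄-attached (true  ∷ true  ∷ true  ∷ false ∷ []) = inj₂ (_ , _ , is-K₅-e , by-map (0F ∷ 4F ∷ 1F ∷ 2F ∷ 3F ∷ []))
K₄-attached (true  ∷ true  ∷ false ∷ true  ∷ []) = inj₂ (_ , _ , is-K₅-e , by-map (0F ∷ 3F ∷ 1F ∷ 2F ∷ 4F ∷ []))
K₄-attached (true  ∷ true  ∷ false ∷ false ∷ []) = inj₂ (_ , _ , is-X₂ , by-map (3F ∷ 4F ∷ 0F ∷ 1F ∷ 2F ∷ []))
K₄-attached (true  ∷ false ∷ true  ∷ true  ∷ []) = inj₂ (_ , _ , is-K₅-e , by-map (0F ∷ 2F ∷ 1F ∷ 3F ∷ 4F ∷ []))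
K₄-attached (true  ∷ false ∷ true  ∷ false ∷ []) = inj₂ (_ , _ , is-X₂ , by-map (2F ∷ 4F ∷ 0F ∷ 1F ∷ 3F ∷ []))
K₄-attached (true  ∷ false ∷ false ∷ true  ∷ []) = inj₂ (_ , _ , is-X₂ , by-map (2F ∷ 3F ∷ 0F ∷ 1F ∷ 4F ∷ []))
K₄-attached (true  ∷ false ∷ false ∷ false ∷ []) = inj₂ (_ , _ , is-K₄+l , by-map (0F ∷ 1F ∷ 2F ∷ 3F ∷ 4F ∷ []))
K₄-attached (false ∷ true  ∷ true  ∷ true  ∷ []) = inj₂ (_ , _ , is-K₅-e , by-map (0F ∷ 1F ∷ 2F ∷ 3F ∷ 4F ∷ []))
K₄-attached (false ∷ true  ∷ true  ∷ false ∷ []) = inj₂ (_ , _ , is-X₂ , by-map (1F ∷ 4F ∷ 0F ∷ 2F ∷ 3F ∷ []))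
K₄-attached (false ∷ true  ∷ false ∷ true  ∷ []) = inj₂ (_ , _ , is-X₂ , by-map (1F ∷ 3F ∷ 0F ∷ 2F ∷ 4F ∷ []))
K₄-attached (false ∷ true  ∷ false ∷ false ∷ []) = inj₂ (_ , _ , is-K₄+l , by-map (0F ∷ 2F ∷ 1F ∷ 3F ∷ 4F ∷ []))
K₄-attached (false ∷ false ∷ true  ∷ true  ∷ []) = inj₂ (_ , _ , is-X₂ , by-map (1F ∷ 2F ∷ 0F ∷ 3F ∷ 4F ∷ []))
K₄-attached (false ∷ false ∷ true  ∷ false ∷ []) = inj₂ (_ , _ , is-K₄+l , by-map (0F ∷ 3F ∷ 1F ∷ 2F ∷ 4F ∷ []))
K₄-attached (false ∷ false ∷ false ∷ true  ∷ []) = inj₂ (_ , _ , is-K₄+l , by-map (0F ∷ 4F ∷ 1F ∷ 2F ∷ 3F ∷ []))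
K₄-attached (false ∷ false ∷ false ∷ false ∷ []) = inj₁ refl

-- A K₄ arises when both vertices of degree 3 and one of degree 2 are neighbours. It is made to
-- start at `3F`, the old vertex 2 of the diamond, so that it can be located in the component.
diamond-attached : ∀ S → S ≡ ∅ ⊎ ContainsForbidden (diamond +vertex S) ⊎
  ∃ λ (e : complete 4 ⊑ diamond +vertex S) → embed e 0F ≡ 3F
diamond-attached (true  ∷ true  ∷ true  ∷ true  ∷ []) = inj₂ (inj₂ (by-map (3F ∷ 0F ∷ 1F ∷ 4F ∷ []) , refl))
diamond-attached (true  ∷ true  ∷ true  ∷ false ∷ []) = inj₂ (inj₁ (_ , _ , is-4-wheel , by-map (3F ∷ 0F ∷ 1F ∷ 4F ∷ 2F ∷ [])))
diamond-attached (true  ∷ true  ∷ false ∷ true  ∷ []) = inj₂ (inj₁ (_ , _ , is-4-wheel , by-map (4F ∷ 0F ∷ 1F ∷ 3F ∷ 2F ∷ [])))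
diamond-attached (true  ∷ true  ∷ false ∷ false ∷ []) = inj₂ (inj₁ (_ , _ , is-X₁ , by-map (0F ∷ 1F ∷ 2F ∷ 3F ∷ 4F ∷ [])))
diamond-attached (true  ∷ false ∷ true  ∷ true  ∷ []) = inj₂ (inj₂ (by-map (3F ∷ 0F ∷ 1F ∷ 4F ∷ []) , refl))
diamond-attached (true  ∷ false ∷ true  ∷ false ∷ []) = inj₂ (inj₁ (_ , _ , is-gem , by-map (3F ∷ 0F ∷ 1F ∷ 4F ∷ 2F ∷ [])))
diamond-attached (true  ∷ false ∷ false ∷ true  ∷ []) = inj₂ (inj₁ (_ , _ , is-gem , by-map (4F ∷ 0F ∷ 1F ∷ 3F ∷ 2F ∷ [])))
diamond-attached (true  ∷ false ∷ false ∷ false ∷ []) = inj₂ (inj₁ (_ , _ , is-kite , by-map (0F ∷ 1F ∷ 2F ∷ 3F ∷ 4F ∷ [])))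
diamond-attached (false ∷ true  ∷ true  ∷ true  ∷ []) = inj₂ (inj₂ (by-map (3F ∷ 0F ∷ 2F ∷ 4F ∷ []) , refl))
diamond-attached (false ∷ true  ∷ true  ∷ false ∷ []) = inj₂ (inj₁ (_ , _ , is-gem , by-map (3F ∷ 0F ∷ 2F ∷ 4F ∷ 1F ∷ [])))
diamond-attached (false ∷ true  ∷ false ∷ true  ∷ []) = inj₂ (inj₁ (_ , _ , is-gem , by-map (4F ∷ 0F ∷ 2F ∷ 3F ∷ 1F ∷ [])))
diamond-attached (false ∷ true  ∷ false ∷ false ∷ []) = inj₂ (inj₁ (_ , _ , is-kite , by-map (0F ∷ 2F ∷ 1F ∷ 3F ∷ 4F ∷ [])))
diamond-attached (false ∷ false ∷ true  ∷ true  ∷ []) = inj₂ (inj₁ (_ , _ , is-claw , by-map (3F ∷ 0F ∷ 1F ∷ 2F ∷ [])))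
diamond-attached (false ∷ false ∷ true  ∷ false ∷ []) = inj₂ (inj₁ (_ , _ , is-claw , by-map (3F ∷ 0F ∷ 1F ∷ 2F ∷ [])))
diamond-attached (false ∷ false ∷ false ∷ true  ∷ []) = inj₂ (inj₁ (_ , _ , is-claw , by-map (4F ∷ 0F ∷ 1F ∷ 2F ∷ [])))
diamond-attached (false ∷ false ∷ false ∷ false ∷ []) = inj₁ refl

anyVec? : ∀ {k} {P : Vec (Fin n) k → Set} → Decidable P → Dec (∃ P)
anyVec? {k = zero}  P? = map′ ([] ,_) (λ { ([] , p) → p }) (P? [])
anyVec? {k = suc k} P? = map′ (λ (x , xs , p) → x ∷ xs , p) (λ { (x ∷ xs , p) → x , xs , p })
  (any? λ x → anyVec? λ xs → P? (x ∷ xs))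

-- The patterns sought are connected, so one vertex in a component places the whole copy there.
contains? : (H : Graph (Fin (suc k))) (G : Graph (Fin n)) (S : Subset n) →
            Dec (∃ λ (e : H ⊑ G) → embed e 0F ∈ S)
contains? H G S = map′
  (λ (f , is , 0∈) → toEmbedding f is , 0∈)
  (λ (e , 0∈) → tabulate (embed e) , isEmbedding e , subst (_∈ S) (sym (lookup∘tabulate (embed e) 0F)) 0∈)
  (anyVec? λ f → isEmbedding? H G f ×-dec lookup f 0F ∈? S)
  where
  isEmbedding : (e : H ⊑ G) → IsEmbedding H G (tabulate (embed e))
  isEmbedding e u v rewrite lookup∘tabulate (embed e) u | lookup∘tabulate (embed e) v =
    injective e , preserves e u v

⊑-restrict : {H : Graph (Fin k)} {G : Graph (Fin n)} {S : Subset n} (e : H ⊑ G) →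
             (∀ {u} → u ∈ S → Image e u) → G [ S ] ⊑ H
⊑-restrict {H = H} {G} {S} e surj = record
  { embed     = λ (u , u∈) → proj₁ (surj u∈)
  ; injective = λ { {u , u∈} {v , v∈} eq → inj u∈ v∈
      (trans (sym (proj₂ (surj u∈))) (trans (cong (embed e) eq) (proj₂ (surj v∈)))) }
  ; preserves = λ (u , u∈) (v , v∈) →
      trans (sym (preserves e _ _)) (cong₂ (adj G) (proj₂ (surj u∈)) (proj₂ (surj v∈)))
  }
  where
  inj : ∀ {u v} (u∈ : u ∈ S) (v∈ : v ∈ S) → u ≡ v → (u , u∈) ≡ (v , v∈)
  inj u∈ v∈ refl = cong (_ ,_) ([]=-irrelevant u∈ v∈)

even-or-odd : ∀ n → (∃ λ m → n ≡ 2 * m) ⊎ (∃ λ m → n ≡ 2 * m + 1)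
even-or-odd zero    = inj₁ (0 , refl)
even-or-odd (suc n) with even-or-odd n
... | inj₁ (m , refl) = inj₂ (m , ℕ.+-comm 1 (2 * m))
... | inj₂ (m , refl) = inj₁ (suc m , size m)
  where
  size : ∀ m → suc (2 * m + 1) ≡ 2 * suc m
  size = solve-∀

Classified : Graph V → Set
Classified G =
  (G ⊑ complete 4)
  ⊎ (G ⊑ diamond)
  ⊎ (∃ λ (m : ℕ) → 2 ≤ m × G ⊑ cycle (2 * m))
  ⊎ (∃ λ (m : ℕ) → G ⊑ butterfly (2 * m + 1))

grow-K₃⊑butterfly : ∀ j → grow K₃ j ⊑ butterfly j
grow-K₃⊑butterfly j = ⊑-trans (⊑-trans (⊑+vertex _ _) (⊑+vertex _ _)) (twoTriangles⊑butterfly j)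

-- A tail of even length is lengthened by one edge to fit into an odd butterfly.
grow-K₃-classified : {F : Graph V} → ∀ j → F ⊑ grow K₃ j → Classified F
grow-K₃-classified {F = F} j e with even-or-odd j
... | inj₂ (m , refl) = inj₂ (inj₂ (inj₂ (m , ⊑-trans e (grow-K₃⊑butterfly j))))
... | inj₁ (m , refl) = inj₂ (inj₂ (inj₂ (m , ⊑-trans e
  (subst (λ n → grow K₃ j ⊑ butterfly n) (ℕ.+-comm 1 j)
    (⊑-trans (⊑+vertex (grow K₃ j) ⁅ 0F ⁆) (grow-K₃⊑butterfly (suc j)))))))

closedPath-classified : {F : Graph V} → ∀ m → F ⊑ closedPath (2 * m + 1) → Classified F
closedPath-classified {F = F} m e = inj₂ (inj₂ (inj₁ (2 + m , s≤s (s≤s z≤n) ,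
  subst (λ n → F ⊑ cycle n) (size m) (⊑-trans e (closedPath⊑cycle (2 * m + 1))))))
  where
  size : ∀ m → 3 + (2 * m + 1) ≡ 2 * (2 + m)
  size = solve-∀

-- `closedPath j` has `3 + j` vertices, an even number for odd `j`; for even `j` the path is
-- lengthened first.
grow-K₂-classified : {F : Graph V} → ∀ j → F ⊑ grow K₂ j → Classified F
grow-K₂-classified j e with even-or-odd j
... | inj₂ (m , refl) = closedPath-classified m (⊑-trans e (⊑+vertex _ _))
... | inj₁ (m , refl) = closedPath-classified m (⊑-trans e (⊑-trans (⊑+vertex (grow K₂ j) ⁅ 0F ⁆)
  (subst (λ i → grow K₂ i ⊑ closedPath (j + 1)) (ℕ.+-comm j 1) (⊑+vertex _ _))))

-- Classification of a single component

module _ (G : Graph V) (free : Free ForbiddenGraph G) where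

  not-forbidden : {H : Graph U} → ContainsForbidden H → ¬ H ⊑ G
  not-forbidden (k , F , forbidden , F⊑H) H⊑G = free forbidden (⊑-trans F⊑H H⊑G)

module Component {n} (G : Graph (Fin n)) (free : Free ForbiddenGraph G)
                 (S : Subset n) (isComponent : IsComponent G S) where

  root : Fin n
  root = proj₁ isComponent

  reachable : ∀ {u} → u ∈ S → Star (Adj G) root u
  reachable = Equivalence.to (proj₂ isComponent _)

  root∈S : root ∈ S
  root∈S = Equivalence.from (proj₂ isComponent _) ε

  S-closed : ∀ {u v} → u ∈ S → Adj G u v → v ∈ S
  S-closed u∈S uv = Equivalence.from (proj₂ isComponent _) (reachable u∈S ◅◅ (uv ◅ ε))

  -- An image closed under adjacency that meets the component contains everything reachable, hence
  -- all of it.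
  covered : {H : Graph (Fin k)} (e : H ⊑ G) → ∀ {i} → embed e i ∈ S →
            (∀ i {w} → Adj G (embed e i) w → Image e w) → G [ S ] ⊑ H
  covered e {i} i∈S closed = ⊑-restrict e λ u∈S →
    spread (Star.reverse (Adj-sym G) (reachable i∈S) ◅◅ reachable u∈S) (i , refl)
    where
    spread : ∀ {u v} → Star (Adj G) u v → Image e u → Image e v
    spread ε         im         = im
    spread (uw ◅ wv) (i , refl) = spread wv (closed i uw)

  attach : {H : Graph (Fin k)} (e : H ⊑ G) → ∀ {i w} → Adj G (embed e i) w → ¬ Image e w →
           ∃ λ T → T ≢ ∅ × ∃ λ (e′ : H +vertex T ⊑ G) → ∀ i → embed e′ (suc i) ≡ embed e i
  attach {H = H} e {i} {w} iw w∉ =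
    T′ , nonempty , extend T′ e w (λ i eq → w∉ (i , eq)) (λ i → sym (lookup∘tabulate _ i)) , λ _ → refl
    where
    T′ : Subset _
    T′ = tabulate λ i → adj G w (embed e i)
    nonempty : T′ ≢ ∅
    nonempty eq = contradiction (begin
      true                       ≡⟨ T⇒≡true (Adj-sym G iw) ⟨
      adj G w (embed e i)        ≡⟨ lookup∘tabulate _ i ⟨
      lookup T′ i                ≡⟨ cong (λ T → lookup T i) eq ⟩
      lookup ∅ i                 ≡⟨ lookup-∅ i ⟩
      false                      ∎) λ ()
      where open ≡-Reasoning

  K₄-component : (e : complete 4 ⊑ G) → embed e 0F ∈ S → G [ S ] ⊑ complete 4
  K₄-component e 0∈S = covered e 0∈S λ i {w} iw → decidable-stable (image? e w) λ w∉ → impossible (attach e iw w∉)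
    where
    impossible : ¬ ∃ λ T → T ≢ ∅ × ∃ λ (e′ : complete 4 +vertex T ⊑ G) → ∀ i → embed e′ (suc i) ≡ embed e i
    impossible (T , T≢∅ , e′ , _) with K₄-attached T
    ... | inj₁ T≡∅       = T≢∅ T≡∅
    ... | inj₂ forbidden = not-forbidden G free forbidden e′

  NoK₄ : Set
  NoK₄ = ¬ ∃ λ (e : complete 4 ⊑ G) → embed e 0F ∈ S

  diamond-component : NoK₄ → (e : diamond ⊑ G) → embed e 0F ∈ S → G [ S ] ⊑ diamond
  diamond-component noK₄ e 0∈S =
    covered e 0∈S λ i {w} iw → decidable-stable (image? e w) λ w∉ → impossible (attach e iw w∉)
    where
    2∈S : embed e 2F ∈ S
    2∈S = S-closed 0∈S (≡true⇒T (preserves e 0F 2F))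
    impossible : ¬ ∃ λ T → T ≢ ∅ × ∃ λ (e′ : diamond +vertex T ⊑ G) → ∀ i → embed e′ (suc i) ≡ embed e i
    impossible (T , T≢∅ , e′ , same) with diamond-attached T
    ... | inj₁ T≡∅              = T≢∅ T≡∅
    ... | inj₂ (inj₁ forbidden) = not-forbidden G free forbidden e′
    ... | inj₂ (inj₂ (f , eq))  =
      noK₄ (⊑-trans f e′ , subst (_∈ S) (sym (trans (cong (embed e′) eq) (same 2F))) 2∈S)

  claw-free : ClawFree G
  claw-free {c} {x} {y} {z} cx cy cz x≢y x≢z y≢z
    with T? (adj G x y) | T? (adj G x z) | T? (adj G y z)
  ... | yes xy | _      | _      = inj₁ xy
  ... | no _   | yes xz | _      = inj₂ (inj₁ xz)
  ... | no _   | no _   | yes yz = inj₂ (inj₂ yz)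
  ... | no ¬xy | no ¬xz | no ¬yz = contradiction
    (build G claw (c ∷ x ∷ y ∷ z ∷ [])
      ((cx , cy , cz , tt) , ((x≢y , ¬xy) , (x≢z , ¬xz) , tt) , ((y≢z , ¬yz) , tt) , tt , tt))
    (free is-claw)

  module DiamondFree (noK₄ : NoK₄) (noDiamond : ¬ ∃ λ (e : diamond ⊑ G) → embed e 0F ∈ S) where

    -- Two distinct common neighbours of an edge span a K₄ or a diamond with it.
    common-neighbour : ∀ {a b x y} → a ∈ S → Adj G a b → Adj G a x → Adj G b x → Adj G a y → Adj G b y →
                       x ≡ y
    common-neighbour {a} {b} {x} {y} a∈S ab ax bx ay by with x ≟ y | T? (adj G x y)
    ... | yes x≡y | _      = x≡y
    ... | no x≢y  | yes xy = contradiction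
      (build G (complete 4) (a ∷ b ∷ x ∷ y ∷ []) ((ab , ax , ay , tt) , (bx , by , tt) , (xy , tt) , tt , tt) , a∈S) noK₄
    ... | no x≢y  | no ¬xy = contradiction
      (build G diamond (x ∷ y ∷ a ∷ b ∷ [])
        (((x≢y , ¬xy) , Adj-sym G ax , Adj-sym G bx , tt) , (Adj-sym G ay , Adj-sym G by , tt) , (ab , tt) , tt , tt)
      , S-closed a∈S ax) noDiamond

    not-both : ∀ {a b c x} → a ∈ S → Adj G a b → Adj G a c → Adj G b c → x ≢ c → Adj G x a → ¬ Adj G x b
    not-both a∈S ab ac bc x≢c xa xb = x≢c (sym (common-neighbour a∈S ab ac bc (Adj-sym G xa) (Adj-sym G xb)))

    -- Otherwise claw-freeness at `a` with leaves `b`, `x`, `y` makes `x` and `y` adjacent, and two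
    -- triangles sharing only `a` form the 0-butterfly.
    outer-same : ∀ {a b c x y} → a ∈ S → Adj G a b → Adj G a c → Adj G b c →
                 x ≢ b → x ≢ c → y ≢ b → y ≢ c → Adj G x a → Adj G y a → x ≡ y
    outer-same {a} {b} {c} {x} {y} a∈S ab ac bc x≢b x≢c y≢b y≢c xa ya with x ≟ y
    ... | yes x≡y = x≡y
    ... | no  x≢y with claw-free ab (Adj-sym G xa) (Adj-sym G ya) (x≢b ∘ sym) (y≢b ∘ sym) x≢y
    ...   | inj₁ bx        = contradiction (Adj-sym G bx) (not-both a∈S ab ac bc x≢c xa)
    ...   | inj₂ (inj₁ by) = contradiction (Adj-sym G by) (not-both a∈S ab ac bc y≢c ya)
    ...   | inj₂ (inj₂ xy) = contradiction
      (build G (butterfly 0) (x ∷ y ∷ a ∷ b ∷ c ∷ [])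
        ( (xy , xa , (x≢b , not-both a∈S ab ac bc x≢c xa) , (x≢c , not-both a∈S ac ab (Adj-sym G bc) x≢b xa) , tt)
        , (ya , (y≢b , not-both a∈S ab ac bc y≢c ya) , (y≢c , not-both a∈S ac ab (Adj-sym G bc) y≢b ya) , tt)
        , (ab , ac , tt) , (bc , tt) , tt , tt))
      (free (is-even-butterfly 0))

    -- Outer neighbours at two different vertices of a triangle give a house if they are adjacent
    -- and a bull if not.
    outer-different : ∀ {a b c x y} → a ∈ S → Adj G a b → Adj G a c → Adj G b c →
                      x ≢ b → x ≢ c → y ≢ a → y ≢ c → Adj G x a → ¬ Adj G y b
    outer-different {a} {b} {c} {x} {y} a∈S ab ac bc x≢b x≢c y≢a y≢c xa yb = house-or-bull (T? (adj G x y))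
      where
      b∈S : b ∈ S
      b∈S = S-closed a∈S ab
      ¬xb : ¬ Adj G x b
      ¬xb = not-both a∈S ab ac bc x≢c xa
      ¬xc : ¬ Adj G x c
      ¬xc = not-both a∈S ac ab (Adj-sym G bc) x≢b xa
      ¬ya : ¬ Adj G y a
      ¬ya = not-both b∈S (Adj-sym G ab) bc ac y≢c yb
      ¬yc : ¬ Adj G y c
      ¬yc = not-both b∈S bc (Adj-sym G ab) (Adj-sym G ac) y≢a yb
      x≢y : x ≢ y
      x≢y refl = ¬xb yb
      house-or-bull : ¬ Dec (Adj G x y)
      house-or-bull (yes xy) = free is-house (build G house (c ∷ a ∷ b ∷ y ∷ x ∷ [])
        ( (Adj-sym G ac , Adj-sym G bc , (y≢c ∘ sym , ¬yc ∘ Adj-sym G) , (x≢c ∘ sym , ¬xc ∘ Adj-sym G) , tt)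
        , (ab , (y≢a ∘ sym , ¬ya ∘ Adj-sym G) , Adj-sym G xa , tt)
        , (Adj-sym G yb , (x≢b ∘ sym , ¬xb ∘ Adj-sym G) , tt)
        , (Adj-sym G xy , tt) , tt , tt))
      house-or-bull (no ¬xy) = free is-bull (build G bull (x ∷ y ∷ b ∷ a ∷ c ∷ [])
        ( ((x≢y , ¬xy) , (x≢b , ¬xb) , xa , (x≢c , ¬xc) , tt)
        , (yb , (y≢a , ¬ya) , (y≢c , ¬yc) , tt)
        , (Adj-sym G ab , bc , tt) , (ac , tt) , tt , tt))

    outer-unique : OuterUnique G (_∈ S)
    outer-unique a∈S ab ac bc (x≢a , x≢b , x≢c , x~) (y≢a , y≢b , y≢c , y~) = go x~ y~
      where
      ba = Adj-sym G ab
      ca = Adj-sym G ac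
      cb = Adj-sym G bc
      b∈S = S-closed a∈S ab
      c∈S = S-closed a∈S ac
      go : Adj G _ _ ⊎ Adj G _ _ ⊎ Adj G _ _ → Adj G _ _ ⊎ Adj G _ _ ⊎ Adj G _ _ → _ ≡ _
      go (inj₁ xa)        (inj₁ ya)        = outer-same a∈S ab ac bc x≢b x≢c y≢b y≢c xa ya
      go (inj₁ xa)        (inj₂ (inj₁ yb)) = contradiction yb (outer-different a∈S ab ac bc x≢b x≢c y≢a y≢c xa)
      go (inj₁ xa)        (inj₂ (inj₂ yc)) = contradiction yc (outer-different a∈S ac ab cb x≢c x≢b y≢a y≢b xa)
      go (inj₂ (inj₁ xb)) (inj₁ ya)        = contradiction ya (outer-different b∈S ba bc ac x≢a x≢c y≢b y≢c xb)
      go (inj₂ (inj₁ xb)) (inj₂ (inj₁ yb)) = outer-same b∈S ba bc ac x≢a x≢c y≢a y≢c xb yb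
      go (inj₂ (inj₁ xb)) (inj₂ (inj₂ yc)) = contradiction yc (outer-different b∈S bc ba ca x≢c x≢a y≢b y≢a xb)
      go (inj₂ (inj₂ xc)) (inj₁ ya)        = contradiction ya (outer-different c∈S ca cb ab x≢a x≢b y≢c y≢b xc)
      go (inj₂ (inj₂ xc)) (inj₂ (inj₁ yb)) = contradiction yb (outer-different c∈S cb ca ba x≢b x≢a y≢c y≢a xc)
      go (inj₂ (inj₂ xc)) (inj₂ (inj₂ yc)) = outer-same c∈S ca cb ab x≢a x≢b y≢a y≢b xc yc

    outer? : ∀ a b c → Decidable (Outer G a b c)
    outer? a b c x = ¬? (x ≟ a) ×-dec ¬? (x ≟ b) ×-dec ¬? (x ≟ c) ×-dec
                     (T? (adj G x a) ⊎-dec T? (adj G x b) ⊎-dec T? (adj G x c))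

    module Tailed {a b c x} (a∈S : a ∈ S) (ab : Adj G a b) (ac : Adj G a c) (bc : Adj G b c)
                  (x≢b : x ≢ b) (x≢c : x ≢ c) (xa : Adj G x a) where

      open Walk G (_∈? S) claw-free outer-unique K₃ refl c

      start : State 0
      start = record
        { e      = build G K₃ (a ∷ b ∷ c ∷ []) ((ab , ac , tt) , (bc , tt) , tt , tt)
        ; within = within
        ; closed = closed
        ; last   = refl
        }
        where
        within : ∀ i → lookup (a ∷ b ∷ c ∷ []) i ∈ S
        within 0F = a∈S
        within 1F = S-closed a∈S ab
        within 2F = S-closed a∈S ac
        closed : ∀ i {w} → Adj G (lookup (b ∷ c ∷ []) i) w → w ∈ S → ∃ λ i′ → lookup (a ∷ b ∷ c ∷ []) i′ ≡ w
        closed i {w} iw _ with w ≟ a | w ≟ b | w ≟ c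
        closed i  iw _ | yes refl | _        | _        = 0F , refl
        closed i  iw _ | no _     | yes refl | _        = 1F , refl
        closed i  iw _ | no _     | no _     | yes refl = 2F , refl
        -- Since `x` is attached at `a`, neither `b` nor `c` has a neighbour outside the triangle.
        closed 0F bw _ | no w≢a   | no _     | no w≢c   =
          contradiction (Adj-sym G bw) (outer-different a∈S ab ac bc x≢b x≢c w≢a w≢c xa)
        closed 1F cw _ | no w≢a   | no w≢b   | no _     =
          contradiction (Adj-sym G cw) (outer-different a∈S ac ab (Adj-sym G bc) x≢c x≢b w≢a w≢b xa)

      classified : Classified (G [ S ])
      classified = by-outcome (walk start)
        where
        by-outcome : Outcome → Classified (G [ S ])
        by-outcome (dead-end j e within closed _) =
          grow-K₃-classified j (covered e (within 0F) λ i iw → closed i iw (S-closed (within i) iw))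
        by-outcome (triangle-end j e within closed) with even-or-odd j
        ... | inj₁ (m , refl) = contradiction (⊑-trans (butterfly⊑twoTriangles j) e) (free (is-even-butterfly m))
        ... | inj₂ (m , refl) = inj₂ (inj₂ (inj₂ (m , ⊑-trans
          (covered e (within 0F) λ i iw → closed i iw (S-closed (within i) iw)) (twoTriangles⊑butterfly j))))

    triangle-classified : (e : K₃ ⊑ G) → embed e 0F ∈ S → Classified (G [ S ])
    triangle-classified e 0∈S = cases (any? (outer? a b c))
      where
      a b c : Fin n
      a = embed e 0F
      b = embed e 1F
      c = embed e 2F
      ab : Adj G a b
      ab = ≡true⇒T (preserves e 0F 1F)
      ac : Adj G a c
      ac = ≡true⇒T (preserves e 0F 2F)
      bc : Adj G b c
      bc = ≡true⇒T (preserves e 1F 2F)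

      adjacent : ∀ i {w} → Adj G (embed e i) w → Adj G w a ⊎ Adj G w b ⊎ Adj G w c
      adjacent 0F aw = inj₁ (Adj-sym G aw)
      adjacent 1F bw = inj₂ (inj₁ (Adj-sym G bw))
      adjacent 2F cw = inj₂ (inj₂ (Adj-sym G cw))

      cases : Dec (∃ (Outer G a b c)) → Classified (G [ S ])
      cases (no ¬outer) = inj₁ (⊑-trans (covered e 0∈S closed) (by-map (0F ∷ 1F ∷ 2F ∷ [])))
        where
        closed : ∀ i {w} → Adj G (embed e i) w → Image e w
        closed i {w} iw = decidable-stable (image? e w) λ w∉ → ¬outer
          (w , (λ eq → w∉ (0F , sym eq)) , (λ eq → w∉ (1F , sym eq)) , (λ eq → w∉ (2F , sym eq)) , adjacent i iw)
      cases (yes (x , x≢a , x≢b , x≢c , inj₁ xa)) =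
        Tailed.classified 0∈S ab ac bc x≢b x≢c xa
      cases (yes (x , x≢a , x≢b , x≢c , inj₂ (inj₁ xb))) =
        Tailed.classified (S-closed 0∈S ab) (Adj-sym G ab) bc ac x≢a x≢c xb
      cases (yes (x , x≢a , x≢b , x≢c , inj₂ (inj₂ xc))) =
        Tailed.classified (S-closed 0∈S ac) (Adj-sym G ac) (Adj-sym G bc) ab x≢a x≢b xc

  module TriangleFree (noTriangle : ¬ ∃ λ (e : K₃ ⊑ G) → embed e 0F ∈ S) where

    no-triangle : ∀ {a b c} → a ∈ S → Adj G a b → Adj G a c → ¬ Adj G b c
    no-triangle {a} {b} {c} a∈S ab ac bc =
      noTriangle (build G K₃ (a ∷ b ∷ c ∷ []) ((ab , ac , tt) , (bc , tt) , tt , tt) , a∈S)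

    two-neighbours : ∀ {a x y z} → a ∈ S → Adj G a x → Adj G a y → x ≢ y → Adj G a z → z ≡ x ⊎ z ≡ y
    two-neighbours {x = x} {y} {z} a∈S ax ay x≢y az with z ≟ x | z ≟ y
    ... | yes z≡x | _       = inj₁ z≡x
    ... | no _    | yes z≡y = inj₂ z≡y
    ... | no z≢x  | no z≢y  with claw-free ax ay az x≢y (z≢x ∘ sym) (z≢y ∘ sym)
    ...   | inj₁ xy        = contradiction xy (no-triangle a∈S ax ay)
    ...   | inj₂ (inj₁ xz) = contradiction xz (no-triangle a∈S ax az)
    ...   | inj₂ (inj₂ yz) = contradiction yz (no-triangle a∈S ay az)

    no-outer : OuterUnique G (_∈ S)
    no-outer a∈S ab ac bc = contradiction bc (no-triangle a∈S ab ac)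

    TwoNeighbours : Fin n → Set
    TwoNeighbours w = ∃₂ λ x y → x ≢ y × Adj G w x × Adj G w y

    twoNeighbours? : Decidable TwoNeighbours
    twoNeighbours? w = any? λ x → any? λ y → ¬? (x ≟ y) ×-dec T? (adj G w x) ×-dec T? (adj G w y)

    module Leaf {w x} (w∈S : w ∈ S) (wx : Adj G w x) (¬two : ¬ TwoNeighbours w) where

      open Walk G (_∈? S) claw-free no-outer K₂ refl w

      start : State 0
      start = record
        { e      = build G K₂ (x ∷ w ∷ []) ((Adj-sym G wx , tt) , tt , tt)
        ; within = within
        ; closed = closed
        ; last   = refl
        }
        where
        within : ∀ i → lookup (x ∷ w ∷ []) i ∈ S
        within 0F = S-closed w∈S wx
        within 1F = w∈S
        closed : ∀ (i : Fin 1) {u} → Adj G (lookup (w ∷ []) i) u → u ∈ S →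
                 ∃ λ i′ → lookup (x ∷ w ∷ []) i′ ≡ u
        closed 0F {u} wu _ = 0F , decidable-stable (x ≟ u) λ x≢u → ¬two (x , u , x≢u , wx , wu)

      classified : Classified (G [ S ])
      classified = by-outcome (walk start)
        where
        by-outcome : Outcome → Classified (G [ S ])
        by-outcome (dead-end j e within closed _) =
          grow-K₂-classified j (covered e (within 0F) λ i iw → closed i iw (S-closed (within i) iw))
        by-outcome (triangle-end j e within closed) = contradiction (≡true⇒T (preserves e 1F 2F))
          (no-triangle (within 0F) (≡true⇒T (preserves e 0F 1F)) (≡true⇒T (preserves e 0F 2F)))

    -- The walk starts with the edge from the root to r and avoids the other
    -- neighbour p of the root, which then closes the cycle.
    module Cycle (two : ∀ {w} → w ∈ S → TwoNeighbours w)
                 {r p} (r≢p : r ≢ p) (root-r : Adj G root r) (root-p : Adj G root p) where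

      Avoiding : Fin n → Set
      Avoiding w = w ∈ S × w ≢ p

      p∈S : p ∈ S
      p∈S = S-closed root∈S root-p

      avoiding? : Decidable Avoiding
      avoiding? w = w ∈? S ×-dec ¬? (w ≟ p)

      no-outer-avoiding : OuterUnique G Avoiding
      no-outer-avoiding = no-outer ∘ proj₁

      open Walk G avoiding? claw-free no-outer-avoiding K₂ refl root

      start : State 0
      start = record
        { e      = build G K₂ (r ∷ root ∷ []) ((Adj-sym G root-r , tt) , tt , tt)
        ; within = within
        ; closed = closed
        ; last   = refl
        }
        where
        within : ∀ i → Avoiding (lookup (r ∷ root ∷ []) i)
        within 0F = S-closed root∈S root-r , r≢p
        within 1F = root∈S , Adj⇒≢ G root-p
        closed : ∀ (i : Fin 1) {w} → Adj G (lookup (root ∷ []) i) w → Avoiding w →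
                 ∃ λ i′ → lookup (r ∷ root ∷ []) i′ ≡ w
        closed 0F root-w (_ , w≢p) with two-neighbours root∈S root-r root-p r≢p root-w
        ... | inj₁ w≡r = 0F , sym w≡r
        ... | inj₂ w≡p = contradiction w≡p w≢p

      module Close (j : ℕ) (e : grow K₂ j ⊑ G) (within : Within e) (closed : Closed e)
                   (last : embed e (fromℕ (suc (j + 0))) ≡ root) where

        second-neighbour : ∃ λ z → Adj G (embed e 0F) z × z ≢ embed e 1F
        second-neighbour with two (proj₁ (within 0F))
        ... | x , y , x≢y , 0x , 0y with x ≟ embed e 1F
        ...   | no x≢1   = x , 0x , x≢1
        ...   | yes refl = y , 0y , x≢y ∘ sym

        -- The walk has stopped at vertex 0, so its second neighbour is neither on the path nor an
        -- allowed new vertex; only the avoided `p` is left.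
        0-p : Adj G (embed e 0F) p
        0-p with second-neighbour
        ... | z , 0z , z≢1 with z ≟ p
        ...   | yes refl = 0z
        ...   | no z≢p with closed 0F 0z (S-closed (proj₁ (within 0F)) 0z , z≢p)
        ...     | 0F , refl = contradiction refl (Adj⇒≢ G 0z)
        ...     | 1F , refl = contradiction refl z≢1
        ...     | suc (suc i) , refl =
          contradiction 0z (≡false⇒¬T (trans (preserves e 0F (suc (suc i))) (adj-grow-K₂-0 j i)))

        0≢root : embed e 0F ≢ root
        0≢root eq = contradiction (injective e (trans eq (sym last))) λ ()

        p-neighbours : ∀ {w} → Adj G p w → w ≡ embed e 0F ⊎ w ≡ root
        p-neighbours = two-neighbours p∈S (Adj-sym G 0-p) (Adj-sym G root-p) 0≢root

        closing : closedPath j ⊑ G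
        closing = extend (ends j) e p (λ i → proj₂ (within i)) row
          where
          row : ∀ i → adj G p (embed e i) ≡ lookup (ends j) i
          row zero    = T⇒≡true (Adj-sym G 0-p)
          row (suc i) with i ≟ fromℕ (j + 0)
          ... | yes refl = trans (T⇒≡true (subst (Adj G p) (sym last) (Adj-sym G root-p))) (sym (lookup-⁅⁆-≡ i))
          ... | no  i≢l  = trans (¬T⇒≡false not-adjacent) (sym (lookup-⁅⁆-≢ i≢l))
            where
            not-adjacent : ¬ Adj G p (embed e (suc i))
            not-adjacent pi with p-neighbours pi
            ... | inj₁ eq = contradiction (injective e eq) λ ()
            ... | inj₂ eq = i≢l (suc-injective (injective e (trans eq (sym last))))

        closing-closed : ∀ i {w} → Adj G (embed closing i) w → Image closing w
        closing-closed zero    {w} pw with p-neighbours pw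
        ... | inj₁ w≡0    = 1F , sym w≡0
        ... | inj₂ w≡root = suc (fromℕ (suc (j + 0))) , trans last (sym w≡root)
        closing-closed (suc i) {w} iw with w ≟ p
        ... | yes refl = zero , refl
        ... | no  w≢p  with closed i iw (S-closed (proj₁ (within i)) iw , w≢p)
        ...   | i′ , eq = suc i′ , eq

      classified : Classified (G [ S ])
      classified = by-outcome (walk start)
        where
        by-outcome : Outcome → Classified (G [ S ])
        by-outcome (triangle-end j e within closed) = contradiction (≡true⇒T (preserves e 1F 2F))
          (no-triangle (proj₁ (within 0F)) (≡true⇒T (preserves e 0F 1F)) (≡true⇒T (preserves e 0F 2F)))
        -- The closed path has `3 + j` vertices: an even cycle for odd `j`, a triangle for `j = 0`,
        -- and an odd hole for every other even `j`.
        by-outcome (dead-end j e within closed last) with even-or-odd j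
        ... | inj₂ (m , refl) = closedPath-classified m (covered closing {0F} p∈S closing-closed)
          where
          open Close j e within closed last
        ... | inj₁ (zero , refl) = contradiction (≡true⇒T (preserves closing 1F 2F))
          (no-triangle p∈S (≡true⇒T (preserves closing 0F 1F)) (≡true⇒T (preserves closing 0F 2F)))
          where
          open Close j e within closed last
        ... | inj₁ (suc m , refl) = contradiction
          (⊑-trans (subst (λ n → cycle n ⊑ closedPath j) (size m) (cycle⊑closedPath j)) closing)
          (free (is-odd-hole (2 + m) (s≤s (s≤s z≤n))))
          where
          open Close j e within closed last
          size : ∀ m → 3 + 2 * suc m ≡ 2 * (2 + m) + 1
          size = solve-∀

    triangle-free-classified : Classified (G [ S ])
    triangle-free-classified with any? (λ w → w ∈? S ×-dec ¬? (twoNeighbours? w))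
    ... | yes (w , w∈S , ¬two) with any? (λ x → T? (adj G w x))
    ...   | yes (x , wx) = Leaf.classified w∈S wx ¬two
    ...   | no isolated  = inj₁ (⊑-trans
      (covered (build G (complete 1) (w ∷ []) (tt , tt)) {0F} w∈S λ { 0F wx → contradiction (_ , wx) isolated })
      (by-map (0F ∷ [])))
    triangle-free-classified | no ¬leaf = from-root (two root∈S)
      where
      two : ∀ {w} → w ∈ S → TwoNeighbours w
      two {w} w∈S = decidable-stable (twoNeighbours? w) λ ¬two → ¬leaf (w , w∈S , ¬two)
      from-root : TwoNeighbours root → Classified (G [ S ])
      from-root (r , p , r≢p , root-r , root-p) = Cycle.classified two r≢p root-r root-p

  component-classified : Classified (G [ S ])
  component-classified with contains? (complete 4) G S
  ... | yes (e , 0∈S) = inj₁ (K₄-component e 0∈S)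
  ... | no noK₄ with contains? diamond G S
  ...   | yes (e , 0∈S) = inj₂ (inj₁ (diamond-component noK₄ e 0∈S))
  ...   | no noDiamond with contains? K₃ G S
  ...     | yes (e , 0∈S) = DiamondFree.triangle-classified noK₄ noDiamond e 0∈S
  ...     | no noTriangle = TriangleFree.triangle-free-classified noTriangle

-- The four equivalent statements

classified-colourable : {G : Graph V} → Classified G → Colourable G
classified-colourable (inj₁ e)                          = Colourable-⊒ e (twoBlue (complete 4) , twoBlue-K₄-good)
classified-colourable (inj₂ (inj₁ e))                   = Colourable-⊒ e (twoBlue diamond , twoBlue-diamond-good)
classified-colourable (inj₂ (inj₂ (inj₁ (m , 2≤m , e)))) = Colourable-⊒ e (cycle-colourable m 2≤m)
classified-colourable (inj₂ (inj₂ (inj₂ (m , e))))      = Colourable-⊒ e (butterfly-colourable m)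

proposition25 :
  ∀ {n : ℕ} (G : Graph (Fin n)) →
  let
    S₁ = ∃ λ (c : Colouring G) → FreeColouring (MonochromaticOr ʳᵇᵇK₃) c
    S₂ = ∃ λ (c : Colouring G) → FreeColouring (MonochromaticOr ʳʳᵇK₃) c
    S₃ = ∀ (S : Subset n) → IsComponent G S →
           (G [ S ] ⊑ complete 4)
           ⊎ (G [ S ] ⊑ diamond)
           ⊎ (∃ λ (m : ℕ) → 2 ≤ m × G [ S ] ⊑ cycle (2 * m))
           ⊎ (∃ λ (m : ℕ) → G [ S ] ⊑ butterfly (2 * m + 1))
    S₄ = Free ForbiddenGraph G
  in
    (S₁ ⇔ S₂) × (S₂ ⇔ S₃) × (S₃ ⇔ S₄)
proposition25 G = exchange-⇔ G , mk⇔ S₂⇒S₃ S₃⇒S₂ , mk⇔ S₃⇒S₄ S₄⇒S₃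
  where
  S₁⇒S₄ : HasColouring ʳᵇᵇK₃ G → Free ForbiddenGraph G
  S₁⇒S₄ (c , free) = Good⇒Free-Forbidden c (Free⇒Good c free)

  S₄⇒S₃ : Free ForbiddenGraph G → ∀ S → IsComponent G S → Classified (G [ S ])
  S₄⇒S₃ = Component.component-classified G

  S₃⇒S₁ : (∀ S → IsComponent G S → Classified (G [ S ])) → HasColouring ʳᵇᵇK₃ G
  S₃⇒S₁ classified = gluedColouring , Good⇒Free gluedColouring glued-good
    where
    colourable : ∀ S → IsComponent G S → Colourable (G [ S ])
    colourable S isComponent = classified-colourable (classified S isComponent)
    open Glue G colourable

  S₂⇒S₃ : HasColouring ʳʳᵇK₃ G → ∀ S → IsComponent G S → Classified (G [ S ])
  S₂⇒S₃ = S₄⇒S₃ ∘ S₁⇒S₄ ∘ Equivalence.from (exchange-⇔ G)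

  S₃⇒S₂ : (∀ S → IsComponent G S → Classified (G [ S ])) → HasColouring ʳʳᵇK₃ G
  S₃⇒S₂ = Equivalence.to (exchange-⇔ G) ∘ S₃⇒S₁

  S₃⇒S₄ : (∀ S → IsComponent G S → Classified (G [ S ])) → Free ForbiddenGraph G
  S₃⇒S₄ = S₁⇒S₄ ∘ S₃⇒S₁
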